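{- If $p$ and $4p+1$ are both prime, then \[ \sum_{j=1}^{p-1} t_2(j)\left( \sigma(p-j)-4 \sigma\!\left(\tfrac{p-j}{2}\right) \right) = -1. \]
   Context: $t_2(n)=\#\{(x_1,x_2)\in\mathbb{N}_0^2 : n=\frac{x_1(x_1+1)}{2}+\frac{x_2(x_2+1)}{2}\}$, with $\mathbb{N}_0=\{0,1,2,\dots\}$. The function $\sigma$ is defined on $\mathbb{Q}$ by $\sigma(0)=1$, $\sigma(q)=0$ if $q\in\mathbb{Q}\setminus\mathbb{N}_0$, and $\sigma(q)=\sum_{d\mid q} d$ for $q\in\mathbb{N}=\{1,2,\dots\}$. -}

module Defs where

open import Data.Nat using (ℕ; zero; suc; _+_; _*_; _∸_; _≟_)
open import Data.Nat.Divisibility using (_∣?_)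
open import Data.Nat.ListAction using (sum)
open import Data.Nat.DivMod using (_/_)
open import Data.List using (List; []; _∷_; map; filter; upTo; length; applyUpTo; concatMap)
open import Data.Product using (_×_; _,_)
open import Data.Integer using (ℤ; +_; -[1+_])
open import Data.Rational using (ℚ; mkℚ)
open import Relation.Nullary.Decidable using (Dec; yes; no)

tri : ℕ → ℕ
tri x = (x * suc x) / 2

-- t₂(n) = #{(x₁,x₂) ∈ ℕ₀² : n = T(x₁) + T(x₂)}.
-- Since T(x) ≥ x, any solution has x₁, x₂ ≤ n, so we enumerate x₁, x₂ ∈ {0,…,n}.
t₂ : ℕ → ℕ
t₂ n = length (filter (λ xy → n ≟ (tri (Data.Product.proj₁ xy) + tri (Data.Product.proj₂ xy)))
                      (concatMap (λ a → map (λ b → (a , b)) (upTo (suc n))) (upTo (suc n))))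

σℕ : ℕ → ℕ
σℕ m = sum (filter (λ d → d ∣? m) (applyUpTo suc m))

-- σ on ℚ as in the paper: σ(0)=1, σ(q)=0 for q ∉ ℕ₀, σ(q)=Σ_{d∣q} d for q ∈ ℕ
σ : ℚ → ℕ
σ (mkℚ (+ zero) zero _) = 1
σ (mkℚ (+ suc m) zero _) = σℕ (suc m)
σ (mkℚ (+ _) (suc _) _) = 0
σ (mkℚ -[1+ _ ] _ _) = 0

sumFrom1 : ℕ → (ℕ → ℤ) → ℤ
sumFrom1 zero f = + 0
sumFrom1 (suc m) f = sumFrom1 m f Data.Integer.+ f (suc m)

{-# OPTIONS --safe #-}
module Submission where

-- Let ψ = ∑ q^(n(n+1)/2), so that ψ² = ∑ t₂(n) qⁿ.  Gauss's product
-- ψ = ∏ (1 - q^(2k)) / (1 - q^(2k-1)) gives, by logarithmic differentiation,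
--   n t₂(n) = 2 ∑_{0 ≤ j < n} t₂(j) (σ(n-j) - 4 σ((n-j)/2)),
-- where σ(·/2) is read as 0 at odd arguments.  For p odd and prime the term j = 0
-- is σ(p) = p + 1.  Since 8 T(x) + 1 = (2x+1)², representations p = T(x) + T(y)
-- correspond to representations of 4p + 1 as a sum of two squares; as 4p + 1 is
-- prime this gives t₂(p) = 2, and hence 2p = 2(p + 1 + S).  (p = 2 is excluded,
-- 9 not being prime.)
--
-- Gauss's product is obtained modulo q^(2n+1) from Shanks's finite identity
--   ∑_{i ≤ 2n} q^T(i) = P n · ∑_{s ≤ n} q^(s(2n+1)) / P s,
-- with P n the n-th partial product: the terms with s ≥ 1 on the right vanish.
-- Representability of 4p + 1 comes from Zagier's involution on x² + 4yz = 4p + 1,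
-- uniqueness from N ∣ (ad - bc)(ad + bc) when a² + b² = c² + d² = N = 4p + 1.

open import Defs
open import Algebra.Bundles using (CommutativeRing)
open import Data.Nat using (ℕ; zero; suc; _∸_; _≤_; _<_; z≤n; s≤s)
import Data.Nat as ℕ
import Data.Nat.Properties as ℕ
open import Data.Nat.Divisibility
open import Data.Nat.Primality using (Prime; ¬prime[0]; ¬prime[1]; prime⇒irreducible)
import Data.Integer.Properties as ℤ
open import Data.Product using (_×_; _,_; proj₁; proj₂; ∃; ∃₂; ∃-syntax)
open import Data.Sum using (_⊎_; inj₁; inj₂; [_,_]′)
open import Function using (_∘_)
open import Relation.Nullary using (Dec; yes; no; ¬_; contradiction)

-- The recursion needs a derivation that survives truncation: d/dq would cost one coefficient,
-- whereas q d/dq multiplies the n-th coefficient by n and so respects congruence modulo q^M. A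
-- finite product congruent to ψ can thus be differentiated in place of the infinite one, and no
-- convergence argument occurs. Divisor sums arise because q d/dq log (1 - q^k) = -k q^k / (1 -
-- q^k), a Lambert series supported on the multiples of k; odd k sit in the denominators of the
-- product and count with sign +, even k with sign -. The passage to two squares hides a factor of
-- 2: adding 8 T(x) + 1 and 8 T(y) + 1 gives (2x+1)² + (2y+1)² = 2 (4p+1). Half the sum and half the
-- difference of the two odd numbers turn this into (x+y+1)² + (x-y)² = 4p + 1. As |x-y| is always
-- the smaller root, the order of the squares is forced, and a representation of p is recovered up
-- to exchanging x and y.

module Triangular where

  open import Data.Nat using (_+_; _*_)
  open import Data.Nat.DivMod using (_/_; +-distrib-/-∣ʳ; m*n/n≡m)
  open import Data.Nat.Properties
  open import Data.Nat.Tactic.RingSolver using (solve-∀)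
  open import Relation.Binary.PropositionalEquality

  -- `tri` contains a rounding division. Later facts about its values go through this doubled form,
  -- where no division is left.
  2*tri : ∀ n → 2 * tri n ≡ n * suc n
  2*tri zero    = refl
  2*tri (suc n) = begin
    2 * tri (suc n)           ≡⟨ cong (2 *_) tri-suc ⟩
    2 * (tri n + suc n)       ≡⟨ *-distribˡ-+ 2 (tri n) (suc n) ⟩
    2 * tri n + 2 * suc n     ≡⟨ cong (_+ 2 * suc n) (2*tri n) ⟩
    n * suc n + 2 * suc n     ≡⟨ lemma n ⟩
    suc n * suc (suc n)       ∎
    where
    open ≡-Reasoning
    lemma : ∀ n → n * suc n + 2 * suc n ≡ suc n * suc (suc n)
    lemma = solve-∀
    lemma′ : ∀ n → suc n * suc (suc n) ≡ n * suc n + suc n * 2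
    lemma′ = solve-∀
    tri-suc : tri (suc n) ≡ tri n + suc n
    tri-suc = begin
      suc n * suc (suc n) / 2          ≡⟨ cong (_/ 2) (lemma′ n) ⟩
      (n * suc n + suc n * 2) / 2      ≡⟨ +-distrib-/-∣ʳ (n * suc n) (divides (suc n) refl) ⟩
      tri n + suc n * 2 / 2            ≡⟨ cong (tri n +_) (m*n/n≡m (suc n) 2) ⟩
      tri n + suc n                    ∎

  tri-unique : ∀ n {t} → 2 * t ≡ n * suc n → tri n ≡ t
  tri-unique n eq = *-cancelˡ-≡ _ _ 2 (trans (2*tri n) (sym eq))

  tri-odd : ∀ n → tri (suc (2 * n)) ≡ suc n * suc (2 * n)
  tri-odd n = tri-unique (suc (2 * n)) (lemma n)
    where
    lemma : ∀ n → 2 * (suc n * suc (2 * n)) ≡ suc (2 * n) * suc (suc (2 * n))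
    lemma = solve-∀

  tri-even : ∀ n → tri (2 * n) ≡ n * suc (2 * n)
  tri-even n = tri-unique (2 * n) (lemma n)
    where
    lemma : ∀ n → 2 * (n * suc (2 * n)) ≡ 2 * n * suc (2 * n)
    lemma = solve-∀

  n≤tri : ∀ n → n ≤ tri n
  n≤tri zero    = z≤n
  n≤tri (suc n) = *-cancelˡ-≤ 2 (begin
    2 * suc n            ≡⟨ *-comm 2 (suc n) ⟩
    suc n * 2            ≤⟨ *-monoʳ-≤ (suc n) (s≤s (s≤s z≤n)) ⟩
    suc n * suc (suc n)  ≡⟨ 2*tri (suc n) ⟨
    2 * tri (suc n)      ∎)
    where open ≤-Reasoning

  2∤odd : ∀ m → ¬ (2 ∣ suc (2 * m))
  2∤odd m d = contradiction (∣1⇒≡1 (∣m+n∣m⇒∣n (subst (2 ∣_) (+-comm 1 (2 * m)) d) (m∣m*n m))) (λ ())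

  even-or-odd : ∀ n → ∃ λ k → n ≡ 2 * k ⊎ n ≡ suc (2 * k)
  even-or-odd zero    = 0 , inj₁ refl
  even-or-odd (suc n) with even-or-odd n
  ... | k , inj₁ refl = k , inj₂ refl
  ... | k , inj₂ refl = suc k , inj₁ (sym (*-suc 2 k))

-- Formal power series over ℤ, their Euler operator and their truncations.

module PowerSeries where

  open import Data.Integer using (ℤ; +_; -_; _+_; _*_)
  open import Data.Integer.Tactic.RingSolver using (solve-∀)
  open import Level using (0ℓ)
  open import Relation.Binary.PropositionalEquality

  Series : Set
  Series = ℕ → ℤ

  tail : Series → Series
  tail f n = f (suc n)

  infixl 6 _⊕_
  infixl 7 _⊛_

  _⊕_ : Series → Series → Series
  (f ⊕ g) n = f n + g n

  ⊝_ : Series → Series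
  (⊝ f) n = - f n

  -- The Cauchy product read off from f = f(0) + q · `tail f`. The recursion is structural in the
  -- index, so the ring laws follow by induction without finite sums.
  _⊛_ : Series → Series → Series
  (f ⊛ g) zero    = f 0 * g 0
  (f ⊛ g) (suc n) = f 0 * g (suc n) + (tail f ⊛ g) n

  const : ℤ → Series
  const c zero    = c
  const c (suc n) = + 0

  X^ : ℕ → Series
  X^ zero            = const (+ 1)
  X^ (suc k) zero    = + 0
  X^ (suc k) (suc n) = X^ k n

  ⊛-cong-≤ : ∀ {f f′ g g′} n → (∀ i → i ≤ n → f i ≡ f′ i) → (∀ i → i ≤ n → g i ≡ g′ i) →
             (f ⊛ g) n ≡ (f′ ⊛ g′) n
  ⊛-cong-≤ zero    p q = cong₂ _*_ (p 0 z≤n) (q 0 z≤n)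
  ⊛-cong-≤ (suc n) p q = cong₂ _+_
    (cong₂ _*_ (p 0 z≤n) (q (suc n) ℕ.≤-refl))
    (⊛-cong-≤ n (λ i i≤n → p (suc i) (s≤s i≤n)) (λ i i≤n → q i (ℕ.m≤n⇒m≤1+n i≤n)))

  ⊛-distribʳ : ∀ h f g n → ((f ⊕ g) ⊛ h) n ≡ (f ⊛ h) n + (g ⊛ h) n
  ⊛-distribʳ h f g zero    = ℤ.*-distribʳ-+ (h 0) (f 0) (g 0)
  ⊛-distribʳ h f g (suc n) = trans
    (cong (_+_ ((f 0 + g 0) * h (suc n))) (⊛-distribʳ h (tail f) (tail g) n))
    (lemma (f 0) (g 0) (h (suc n)) _ _)
    where
    lemma : ∀ a b c x y → (a + b) * c + (x + y) ≡ (a * c + x) + (b * c + y)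
    lemma = solve-∀

  ⊛-scaleˡ : ∀ c f g n → ((λ i → c * f i) ⊛ g) n ≡ c * (f ⊛ g) n
  ⊛-scaleˡ c f g zero    = ℤ.*-assoc c (f 0) (g 0)
  ⊛-scaleˡ c f g (suc n) = trans
    (cong (_+_ (c * f 0 * g (suc n))) (⊛-scaleˡ c (tail f) g n))
    (lemma c (f 0) (g (suc n)) _)
    where
    lemma : ∀ c a b x → c * a * b + c * x ≡ c * (a * b + x)
    lemma = solve-∀

  -- The definition peels the left factor; this peels the right one, by g = g(0) + q · `tail g`.
  -- Commutativity plays the two against each other.
  ⊛-suc : ∀ f g n → (f ⊛ g) (suc n) ≡ (f ⊛ tail g) n + f (suc n) * g 0
  ⊛-suc f g zero    = refl
  ⊛-suc f g (suc n) = trans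
    (cong (_+_ (f 0 * g (suc (suc n)))) (⊛-suc (tail f) g n))
    (sym (ℤ.+-assoc (f 0 * g (suc (suc n))) _ _))

  ⊛-comm : ∀ f g n → (f ⊛ g) n ≡ (g ⊛ f) n
  ⊛-comm f g zero    = ℤ.*-comm (f 0) (g 0)
  ⊛-comm f g (suc n) = begin
    f 0 * g (suc n) + (tail f ⊛ g) n   ≡⟨ cong₂ _+_ (ℤ.*-comm (f 0) (g (suc n))) (⊛-comm (tail f) g n) ⟩
    g (suc n) * f 0 + (g ⊛ tail f) n   ≡⟨ ℤ.+-comm (g (suc n) * f 0) _ ⟩
    (g ⊛ tail f) n + g (suc n) * f 0   ≡⟨ ⊛-suc g f n ⟨
    (g ⊛ f) (suc n)                    ∎
    where open ≡-Reasoning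

  ⊛-distribˡ : ∀ h f g n → (h ⊛ (f ⊕ g)) n ≡ (h ⊛ f) n + (h ⊛ g) n
  ⊛-distribˡ h f g n = trans (⊛-comm h (f ⊕ g) n)
    (trans (⊛-distribʳ h f g n) (cong₂ _+_ (⊛-comm f h n) (⊛-comm g h n)))

  ⊛-assoc : ∀ f g h n → ((f ⊛ g) ⊛ h) n ≡ (f ⊛ (g ⊛ h)) n
  ⊛-assoc f g h zero    = ℤ.*-assoc (f 0) (g 0) (h 0)
  ⊛-assoc f g h (suc n) = begin
    f 0 * g 0 * h (suc n) + (tail (f ⊛ g) ⊛ h) n
      ≡⟨ cong (_+_ (f 0 * g 0 * h (suc n))) (⊛-distribʳ h (λ i → f 0 * tail g i) (tail f ⊛ g) n) ⟩
    f 0 * g 0 * h (suc n) + (((λ i → f 0 * tail g i) ⊛ h) n + ((tail f ⊛ g) ⊛ h) n)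
      ≡⟨ cong₂ (λ x y → f 0 * g 0 * h (suc n) + (x + y)) (⊛-scaleˡ (f 0) (tail g) h n) (⊛-assoc (tail f) g h n) ⟩
    f 0 * g 0 * h (suc n) + (f 0 * (tail g ⊛ h) n + (tail f ⊛ (g ⊛ h)) n)
      ≡⟨ lemma (f 0) (g 0) (h (suc n)) _ _ ⟩
    f 0 * (g 0 * h (suc n) + (tail g ⊛ h) n) + (tail f ⊛ (g ⊛ h)) n ∎
    where
    open ≡-Reasoning
    lemma : ∀ a b c x y → a * b * c + (a * x + y) ≡ a * (b * c + x) + y
    lemma = solve-∀

  ⊛-zeroˡ : ∀ f n → ((λ _ → + 0) ⊛ f) n ≡ + 0
  ⊛-zeroˡ f zero    = refl
  ⊛-zeroˡ f (suc n) = trans (ℤ.+-identityˡ _) (⊛-zeroˡ f n)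

  const-⊛ : ∀ c f n → (const c ⊛ f) n ≡ c * f n
  const-⊛ c f zero    = refl
  const-⊛ c f (suc n) = trans (cong (_+_ (c * f (suc n))) (⊛-zeroˡ f n)) (ℤ.+-identityʳ _)

  X^-suc-⊛ : ∀ k f n → (X^ (suc k) ⊛ f) (suc n) ≡ (X^ k ⊛ f) n
  X^-suc-⊛ k f n = ℤ.+-identityˡ _

  X^-+ : ∀ j k n → (X^ j ⊛ X^ k) n ≡ X^ (j ℕ.+ k) n
  X^-+ zero    k n       = trans (const-⊛ (+ 1) (X^ k) n) (ℤ.*-identityˡ _)
  X^-+ (suc j) k zero    = refl
  X^-+ (suc j) k (suc n) = trans (X^-suc-⊛ j (X^ k) n) (X^-+ j k n)

  X^-< : ∀ {k n} → n < k → X^ k n ≡ + 0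
  X^-< {suc k} {zero}  _         = refl
  X^-< {suc k} {suc n} (s≤s n<k) = X^-< n<k

  -- The Euler operator q d/dq.
  D : Series → Series
  D f n = + n * f n

  -- Since D (q h) = q (h + D h), the tail of `D f` is `tail f ⊕ D (tail f)`. The surplus `tail f`
  -- is supplied by splitting the factor `suc n` as 1 + n.
  D-⊛ : ∀ f g n → D (f ⊛ g) n ≡ (D f ⊛ g) n + (f ⊛ D g) n
  D-⊛ f g zero    = lemma (f 0) (g 0)
    where
    lemma : ∀ a b → + 0 * (a * b) ≡ + 0 * a * b + a * (+ 0 * b)
    lemma = solve-∀
  D-⊛ f g (suc n) = begin
    + suc n * (f 0 * g (suc n) + (tail f ⊛ g) n)
      ≡⟨ cong (_* (f 0 * g (suc n) + (tail f ⊛ g) n)) (ℤ.pos-+ 1 n) ⟩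
    (+ 1 + + n) * (f 0 * g (suc n) + (tail f ⊛ g) n)
      ≡⟨ lemma₁ (+ n) (f 0) (g (suc n)) _ ⟩
    f 0 * ((+ 1 + + n) * g (suc n)) + ((tail f ⊛ g) n + D (tail f ⊛ g) n)
      ≡⟨ cong₂ (λ x y → f 0 * (x * g (suc n)) + ((tail f ⊛ g) n + y)) (sym (ℤ.pos-+ 1 n)) (D-⊛ (tail f) g n) ⟩
    f 0 * D g (suc n) + ((tail f ⊛ g) n + ((D (tail f) ⊛ g) n + (tail f ⊛ D g) n))
      ≡⟨ lemma₂ (f 0) (g (suc n)) (D g (suc n)) ((tail f ⊛ g) n) _ _ ⟩
    (+ 0 * f 0 * g (suc n) + ((tail f ⊛ g) n + (D (tail f) ⊛ g) n)) + (f 0 * D g (suc n) + (tail f ⊛ D g) n)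
      ≡⟨ cong (λ x → (+ 0 * f 0 * g (suc n) + x) + (f 0 * D g (suc n) + (tail f ⊛ D g) n)) (begin
           (tail f ⊛ g) n + (D (tail f) ⊛ g) n  ≡⟨ ⊛-distribʳ g (tail f) (D (tail f)) n ⟨
           ((tail f ⊕ D (tail f)) ⊛ g) n        ≡⟨ ⊛-cong-≤ n (λ i _ → tail-D i) (λ _ _ → refl) ⟩
           (tail (D f) ⊛ g) n                   ∎) ⟩
    (D f ⊛ g) (suc n) + (f ⊛ D g) (suc n) ∎
    where
    open ≡-Reasoning
    tail-D : ∀ i → f (suc i) + + i * f (suc i) ≡ + suc i * f (suc i)
    tail-D i = trans (lemma (+ i) (f (suc i))) (cong (_* f (suc i)) (sym (ℤ.pos-+ 1 i)))
      where
      lemma : ∀ n a → a + n * a ≡ (+ 1 + n) * a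
      lemma = solve-∀
    lemma₁ : ∀ n a b x → (+ 1 + n) * (a * b + x) ≡ a * ((+ 1 + n) * b) + (x + n * x)
    lemma₁ = solve-∀
    lemma₂ : ∀ a b c x y z → a * c + (x + (y + z)) ≡ (+ 0 * a * b + (x + y)) + (a * c + z)
    lemma₂ = solve-∀

  -- ℤ[[q]] / (q^M): equality only compares coefficients below M.
  module Truncated (M : ℕ) where

    infix 4 _≈_
    _≈_ : Series → Series → Set
    f ≈ g = ∀ i → i < M → f i ≡ g i

    ring : CommutativeRing 0ℓ 0ℓ
    ring = record
      { Carrier = Series
      ; _≈_ = _≈_
      ; _+_ = _⊕_
      ; _*_ = _⊛_
      ; -_ = ⊝_
      ; 0# = λ _ → + 0
      ; 1# = const (+ 1)
      ; isCommutativeRing = record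
        { isRing = record
          { +-isAbelianGroup = record
            { isGroup = record
              { isMonoid = record
                { isSemigroup = record
                  { isMagma = record
                    { isEquivalence = record
                      { refl  = λ _ _ → refl
                      ; sym   = λ p i i<M → sym (p i i<M)
                      ; trans = λ p q i i<M → trans (p i i<M) (q i i<M)
                      }
                    ; ∙-cong = λ p q i i<M → cong₂ _+_ (p i i<M) (q i i<M)
                    }
                  ; assoc = λ f g h i _ → ℤ.+-assoc (f i) (g i) (h i)
                  }
                ; identity = (λ f i _ → ℤ.+-identityˡ (f i)) , (λ f i _ → ℤ.+-identityʳ (f i))
                }
              ; inverse = (λ f i _ → ℤ.+-inverseˡ (f i)) , (λ f i _ → ℤ.+-inverseʳ (f i))
              ; ⁻¹-cong = λ p i i<M → cong -_ (p i i<M)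
              }
            ; comm = λ f g i _ → ℤ.+-comm (f i) (g i)
            }
          ; *-cong = λ p q i i<M → ⊛-cong-≤ i
              (λ j j≤i → p j (ℕ.≤-<-trans j≤i i<M)) (λ j j≤i → q j (ℕ.≤-<-trans j≤i i<M))
          ; *-assoc = λ f g h i _ → ⊛-assoc f g h i
          ; *-identity = (λ f i _ → identityˡ f i) , (λ f i _ → trans (⊛-comm f (const (+ 1)) i) (identityˡ f i))
          ; distrib = (λ h f g i _ → ⊛-distribˡ h f g i) , (λ h f g i _ → ⊛-distribʳ h f g i)
          }
        ; *-comm = λ f g i _ → ⊛-comm f g i
        }
      }
      where
      identityˡ : ∀ f i → (const (+ 1) ⊛ f) i ≡ f i
      identityˡ f i = trans (const-⊛ (+ 1) f i) (ℤ.*-identityˡ (f i))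

    D-cong : ∀ {f g} → f ≈ g → D f ≈ D g
    D-cong p i i<M = cong (_*_ (+ i)) (p i i<M)

-- Shanks's identity and logarithmic differentiation in a commutative ring.

module GaussProduct {c ℓ} (R : CommutativeRing c ℓ) where

  import Algebra.Solver.Ring.NaturalCoefficients.Default as SemiringSolver
  import Algebra.Properties.Ring as RingProperties
  open import Data.Nat.Tactic.RingSolver using (solve-∀)
  import Relation.Binary.PropositionalEquality as ≡
  open import Relation.Binary.PropositionalEquality using (_≡_)
  import Relation.Binary.Reasoning.Setoid as SetoidReasoning
  open Triangular using (tri-odd; tri-even)

  open CommutativeRing R
  open RingProperties ring using (-‿distribˡ-*; -‿distribʳ-*)
  open SetoidReasoning setoid
  open SemiringSolver commutativeSemiring

  -- The solver used below is one for commutative semirings, so negatives enter it only as atoms.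
  -- This rule and `telescope` do the work with differences outside it.
  1-x*y : ∀ x y → (1# - x) * y ≈ y - x * y
  1-x*y x y = trans (distribʳ y 1# (- x)) (+-cong (*-identityˡ y) (sym (-‿distribˡ-* x y)))

  telescope : ∀ x y z → (x - y) + (y - z) ≈ x - z
  telescope x y z = begin
    (x - y) + (y - z)   ≈⟨ solve 4 (λ x y y′ z′ → (x :+ y′) :+ (y :+ z′) := (x :+ z′) :+ (y :+ y′)) refl x y (- y) (- z) ⟩
    (x - z) + (y - y)   ≈⟨ trans (+-congˡ (-‿inverseʳ y)) (+-identityʳ _) ⟩
    x - z               ∎

  sum< : ℕ → (ℕ → Carrier) → Carrier
  sum< zero    f = 0#
  sum< (suc n) f = sum< n f + f n

  -- X k stands for q^k and G k, for k ≥ 1, for 1 / (1 - q^k). Division is thereby replaced by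
  -- multiplication with given inverses, in any commutative ring that has them.
  module Multipliers
    (X : ℕ → Carrier) (X-0 : X 0 ≈ 1#) (X-+ : ∀ j k → X j * X k ≈ X (j ℕ.+ k))
    (G : ℕ → Carrier) (G-inverse : ∀ k → (1# - X (suc k)) * G (suc k) ≈ 1#)
    where

    b : ℕ → Carrier
    b k = 1# - X k

    P : ℕ → Carrier
    P zero    = 1#
    P (suc k) = P k * (b (2 ℕ.* suc k) * G (suc (2 ℕ.* k)))

    P⁻¹ : ℕ → Carrier
    P⁻¹ zero    = 1#
    P⁻¹ (suc k) = P⁻¹ k * (b (suc (2 ℕ.* k)) * G (2 ℕ.* suc k))

    P-inverse : ∀ n → P n * P⁻¹ n ≈ 1#
    P-inverse zero    = *-identityˡ 1#
    P-inverse (suc n) = begin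
      P (suc n) * P⁻¹ (suc n)
        ≈⟨ solve 6 (λ p v b g b′ g′ → (p :* (b :* g)) :* (v :* (b′ :* g′)) := (p :* v) :* ((b :* g′) :* (b′ :* g)))
             refl (P n) (P⁻¹ n) (b (2 ℕ.* suc n)) (G (suc (2 ℕ.* n))) (b (suc (2 ℕ.* n))) (G (2 ℕ.* suc n)) ⟩
      (P n * P⁻¹ n) * ((b (2 ℕ.* suc n) * G (2 ℕ.* suc n)) * (b (suc (2 ℕ.* n)) * G (suc (2 ℕ.* n))))
        ≈⟨ *-cong (P-inverse n) (*-cong (G-inverse _) (G-inverse (2 ℕ.* n))) ⟩
      1# * (1# * 1#)
        ≈⟨ trans (*-identityˡ _) (*-identityˡ _) ⟩
      1# ∎

    -- The ratio of consecutive values of `P⁻¹` with its denominator cleared. It rewrites the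
    -- boundary term of the telescoping sum at m + 1 in terms of `P⁻¹ m`.
    P⁻¹-suc : ∀ n → P⁻¹ (suc n) * b (2 ℕ.* suc n) ≈ P⁻¹ n * b (suc (2 ℕ.* n))
    P⁻¹-suc n = begin
      P⁻¹ (suc n) * b (2 ℕ.* suc n)
        ≈⟨ solve 4 (λ v b g b′ → (v :* (b :* g)) :* b′ := (v :* b) :* (b′ :* g))
             refl (P⁻¹ n) (b (suc (2 ℕ.* n))) (G (2 ℕ.* suc n)) (b (2 ℕ.* suc n)) ⟩
      (P⁻¹ n * b (suc (2 ℕ.* n))) * (b (2 ℕ.* suc n) * G (2 ℕ.* suc n))
        ≈⟨ trans (*-congˡ (G-inverse _)) (*-identityʳ _) ⟩
      P⁻¹ n * b (suc (2 ℕ.* n)) ∎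

    X-split : ∀ {i} j k → j ℕ.+ k ≡ i → X i ≈ X j * X k
    X-split j k ≡.refl = sym (X-+ j k)

    shanksTerm : ℕ → ℕ → Carrier
    shanksTerm n s = P⁻¹ s * X (s ℕ.* suc (2 ℕ.* n))

    -- The boundary term is found by noting that, with v = P⁻¹ m, its increment is
    -- v (1 - q^(2m+1)) q^((m+1)(2n+1)) - v (1 - q^(2m)) q^(m(2n+1)).
    shanks-telescope : ∀ n m →
      b (2 ℕ.* suc n) * sum< m (shanksTerm (suc n)) ≈
      b (suc (2 ℕ.* n)) * sum< m (shanksTerm n) + P⁻¹ m * b (2 ℕ.* m) * X (m ℕ.* suc (2 ℕ.* n))
    shanks-telescope n zero = begin
      b (2 ℕ.* suc n) * 0#
        ≈⟨ zeroʳ _ ⟩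
      0#
        ≈⟨ +-identityʳ 0# ⟨
      0# + 0#
        ≈⟨ +-cong (zeroʳ _) (trans (*-congʳ (trans (*-identityˡ _) (trans (+-congˡ (-‿cong X-0)) (-‿inverseʳ 1#)))) (zeroˡ _)) ⟨
      b (suc (2 ℕ.* n)) * 0# + 1# * (1# - X 0) * X 0 ∎
    shanks-telescope n (suc m) = begin
      b (2 ℕ.* suc n) * (Σ′ + shanksTerm (suc n) m)
        ≈⟨ distribˡ _ _ _ ⟩
      b (2 ℕ.* suc n) * Σ′ + b (2 ℕ.* suc n) * shanksTerm (suc n) m
        ≈⟨ +-cong (shanks-telescope n m) (*-cong (+-congˡ (-‿cong x-xw)) (*-congˡ x-tu)) ⟩
      (b (suc (2 ℕ.* n)) * Σ + v * b (2 ℕ.* m) * t) + (1# - x * w) * (v * (t * u))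
        ≈⟨ solve 7 (λ B S v b t b′ u → (B :* S :+ v :* b :* t) :+ b′ :* (v :* (t :* u)) :=
                                       B :* S :+ (b :* (v :* t) :+ b′ :* (u :* (v :* t))))
             refl (b (suc (2 ℕ.* n))) Σ v (b (2 ℕ.* m)) t (1# - x * w) u ⟩
      b (suc (2 ℕ.* n)) * Σ + ((1# - u) * (v * t) + (1# - x * w) * (u * (v * t)))
        -- Both ends collapse to vt - xuw·vt: the two telescoping sums share their outer terms and
        -- differ only in passing through u·vt or through w·vt.
        ≈⟨ +-congˡ (begin
             (1# - u) * (v * t) + (1# - x * w) * (u * (v * t))
               ≈⟨ +-cong (1-x*y _ _) (1-x*y _ _) ⟩
             (v * t - u * (v * t)) + (u * (v * t) - x * w * (u * (v * t)))
               ≈⟨ telescope _ _ _ ⟩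
             v * t - x * w * (u * (v * t))
               ≈⟨ +-congˡ (-‿cong (solve 5 (λ v t x w u → x :* w :* (u :* (v :* t)) := x :* u :* (w :* (v :* t))) refl v t x w u)) ⟩
             v * t - x * u * (w * (v * t))
               ≈⟨ telescope _ _ _ ⟨
             (v * t - w * (v * t)) + (w * (v * t) - x * u * (w * (v * t)))
               ≈⟨ +-cong (1-x*y _ _) (1-x*y _ _) ⟨
             (1# - w) * (v * t) + (1# - x * u) * (w * (v * t)) ∎) ⟩
      b (suc (2 ℕ.* n)) * Σ + ((1# - w) * (v * t) + (1# - x * u) * (w * (v * t)))
        ≈⟨ solve 6 (λ B S v t b′ w → B :* S :+ (B :* (v :* t) :+ b′ :* (w :* (v :* t))) :=
                                     B :* (S :+ v :* t) :+ v :* b′ :* (t :* w))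
             refl (b (suc (2 ℕ.* n))) Σ v t (1# - x * u) w ⟩
      b (suc (2 ℕ.* n)) * (Σ + v * t) + v * (1# - x * u) * (t * w)
        ≈⟨ +-congˡ (*-cong (trans (*-congˡ (+-congˡ (-‿cong (sym x-xu)))) (sym (P⁻¹-suc m))) (sym x-tw)) ⟩
      b (suc (2 ℕ.* n)) * sum< (suc m) (shanksTerm n)
        + P⁻¹ (suc m) * b (2 ℕ.* suc m) * X (suc m ℕ.* suc (2 ℕ.* n)) ∎
      where
      Σ Σ′ v t u w x : Carrier
      Σ  = sum< m (shanksTerm n)
      Σ′ = sum< m (shanksTerm (suc n))
      v = P⁻¹ m
      t = X (m ℕ.* suc (2 ℕ.* n))
      u = X (2 ℕ.* m)
      w = X (suc (2 ℕ.* n))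
      x = X 1
      x-xw : X (2 ℕ.* suc n) ≈ x * w
      x-xw = X-split 1 (suc (2 ℕ.* n)) (lemma n)
        where
        lemma : ∀ n → 1 ℕ.+ suc (2 ℕ.* n) ≡ 2 ℕ.* suc n
        lemma = solve-∀
      x-tu : X (m ℕ.* suc (2 ℕ.* suc n)) ≈ t * u
      x-tu = X-split _ (2 ℕ.* m) (lemma n m)
        where
        lemma : ∀ n m → m ℕ.* suc (2 ℕ.* n) ℕ.+ 2 ℕ.* m ≡ m ℕ.* suc (2 ℕ.* suc n)
        lemma = solve-∀
      x-xu : X (suc (2 ℕ.* m)) ≈ x * u
      x-xu = X-split 1 (2 ℕ.* m) ≡.refl
      x-tw : X (suc m ℕ.* suc (2 ℕ.* n)) ≈ t * w
      x-tw = X-split _ _ (ℕ.+-comm (m ℕ.* suc (2 ℕ.* n)) (suc (2 ℕ.* n)))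

    P-shanksTerm : ∀ n → P n * shanksTerm n n ≈ X (n ℕ.* suc (2 ℕ.* n))
    P-shanksTerm n = trans (sym (*-assoc _ _ _)) (trans (*-congʳ (P-inverse n)) (*-identityˡ _))

    -- Going from n to n + 1 adds two powers of q on the left. The exponent (n+1)(2n+1) is the
    -- boundary term of `shanks-telescope` at m = n + 1, and (n+1)(2n+3) is the new summand s = n +
    -- 1 on the right, where `P` cancels `P⁻¹`.
    shanks : ∀ n → sum< (suc (2 ℕ.* n)) (λ i → X (tri i)) ≈ P n * sum< (suc n) (shanksTerm n)
    shanks zero = begin
      0# + X 0             ≈⟨ +-congˡ (*-identityˡ _) ⟨
      0# + 1# * X 0        ≈⟨ *-identityˡ _ ⟨
      1# * (0# + 1# * X 0) ∎
    shanks (suc n) = begin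
      sum< (suc (2 ℕ.* suc n)) (λ i → X (tri i))
        ≡⟨ ≡.cong (λ k → sum< k (λ i → X (tri i)) + X (tri (2 ℕ.* suc n))) (ℕ.*-suc 2 n) ⟩
      (sum< (suc (2 ℕ.* n)) (λ i → X (tri i)) + X (tri (suc (2 ℕ.* n)))) + X (tri (2 ℕ.* suc n))
        ≈⟨ +-cong (+-cong (shanks n) (reflexive (≡.cong X (tri-odd n)))) (reflexive (≡.cong X (tri-even (suc n)))) ⟩
      (P n * Σ + X e) + X (suc n ℕ.* suc (2 ℕ.* suc n))
        ≈⟨ +-cong step (sym (P-shanksTerm (suc n))) ⟩
      P (suc n) * Σ′ + P (suc n) * shanksTerm (suc n) (suc n)
        ≈⟨ distribˡ _ _ _ ⟨
      P (suc n) * sum< (suc (suc n)) (shanksTerm (suc n)) ∎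
      where
      Σ Σ′ g b₁ b₂ : Carrier
      Σ  = sum< (suc n) (shanksTerm n)
      Σ′ = sum< (suc n) (shanksTerm (suc n))
      g  = G (suc (2 ℕ.* n))
      b₁ = b (suc (2 ℕ.* n))
      b₂ = b (2 ℕ.* suc n)
      e : ℕ
      e  = suc n ℕ.* suc (2 ℕ.* n)
      step : P n * Σ + X e ≈ P (suc n) * Σ′
      step = begin
        P n * Σ + X e
          ≈⟨ +-cong (trans (*-congʳ (*-identityʳ _)) refl) (*-identityˡ _) ⟨
        P n * 1# * Σ + 1# * X e
          ≈⟨ +-cong (*-congʳ (*-congˡ (G-inverse (2 ℕ.* n)))) (*-congʳ (P-inverse (suc n))) ⟨
        P n * (b₁ * g) * Σ + P (suc n) * P⁻¹ (suc n) * X e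
          ≈⟨ solve 7 (λ p b₁ b₂ g S v x → p :* (b₁ :* g) :* S :+ p :* (b₂ :* g) :* v :* x :=
                                          p :* g :* (b₁ :* S :+ v :* b₂ :* x))
               refl (P n) b₁ b₂ g Σ (P⁻¹ (suc n)) (X e) ⟩
        P n * g * (b₁ * Σ + P⁻¹ (suc n) * b₂ * X e)
          ≈⟨ *-congˡ (shanks-telescope n (suc n)) ⟨
        P n * g * (b₂ * Σ′)
          ≈⟨ solve 4 (λ p g b₂ S → p :* g :* (b₂ :* S) := p :* (b₂ :* g) :* S) refl (P n) g b₂ Σ′ ⟩
        P (suc n) * Σ′ ∎

    gauss : ∀ n → (∀ k → X (suc k ℕ.* suc (2 ℕ.* n)) ≈ 0#) →
            sum< (suc (2 ℕ.* n)) (λ i → X (tri i)) ≈ P n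
    gauss n vanish = begin
      sum< (suc (2 ℕ.* n)) (λ i → X (tri i))   ≈⟨ shanks n ⟩
      P n * sum< (suc n) (shanksTerm n)        ≈⟨ *-congˡ (only-first n) ⟩
      P n * 1#                                 ≈⟨ *-identityʳ _ ⟩
      P n                                      ∎
      where
      only-first : ∀ m → sum< (suc m) (shanksTerm n) ≈ 1#
      only-first zero    = trans (+-identityˡ _) (trans (*-identityˡ _) X-0)
      only-first (suc m) = trans (+-cong (only-first m) (trans (*-congˡ (vanish m)) (zeroʳ _))) (+-identityʳ 1#)

    -- L k is minus the logarithmic derivative of 1 - q^k, so in `logDerivative` the denominators of
    -- the product contribute +L and the numerators -L.
    module LogDerivative
      (D : Carrier → Carrier) (D-cong : ∀ {x y} → x ≈ y → D x ≈ D y)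
      (D-1 : D 1# ≈ 0#) (D-* : ∀ x y → D (x * y) ≈ D x * y + x * D y)
      (L : ℕ → Carrier) (D-b : ∀ k → D (b (suc k)) ≈ - (b (suc k) * L (suc k)))
      where

      -- The quotient rule for an inverse: D (β g) = D 1 = 0 gives β · D g = -(D β) g = β l g, and
      -- multiplying by g removes β. The chain inserts -(β l g) + β l g to make this cancellation
      -- visible.
      D-G : ∀ k → D (G (suc k)) ≈ G (suc k) * L (suc k)
      D-G k = begin
        dg                                 ≈⟨ *-identityˡ dg ⟨
        1# * dg                            ≈⟨ *-congʳ (G-inverse k) ⟨
        β * g * dg                         ≈⟨ solve 3 (λ b g d → b :* g :* d := g :* (b :* d)) refl β g dg ⟩
        g * (β * dg)                       ≈⟨ *-congˡ (+-identityʳ _) ⟨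
        g * (β * dg + 0#)                  ≈⟨ *-congˡ (+-congˡ (-‿inverseˡ _)) ⟨
        g * (β * dg + (- (β * l * g) + β * l * g))
          ≈⟨ solve 4 (λ g d m b → g :* (d :+ (m :+ b)) := g :* ((m :+ d) :+ b)) refl g (β * dg) (- (β * l * g)) (β * l * g) ⟩
        g * ((- (β * l * g) + β * dg) + β * l * g)
          ≈⟨ *-congˡ (+-congʳ (begin
               - (β * l * g) + β * dg    ≈⟨ +-congʳ (-‿distribˡ-* _ _) ⟩
               - (β * l) * g + β * dg    ≈⟨ +-congʳ (*-congʳ (D-b k)) ⟨
               D β * g + β * dg          ≈⟨ D-* β g ⟨
               D (β * g)                 ≈⟨ D-cong (G-inverse k) ⟩
               D 1#                      ≈⟨ D-1 ⟩
               0#                        ∎)) ⟩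
        g * (0# + β * l * g)               ≈⟨ *-congˡ (+-identityˡ _) ⟩
        g * (β * l * g)                    ≈⟨ solve 3 (λ b g l → g :* (b :* l :* g) := b :* g :* (g :* l)) refl β g l ⟩
        β * g * (g * l)                    ≈⟨ trans (*-congʳ (G-inverse k)) (*-identityˡ _) ⟩
        g * l                              ∎
        where
        β g l dg : Carrier
        β = b (suc k)
        g = G (suc k)
        l = L (suc k)
        dg = D g

      logDerivative : ℕ → Carrier
      logDerivative n = sum< n (λ k → L (suc (2 ℕ.* k)) - L (2 ℕ.* suc k))

      D-P : ∀ n → D (P n) ≈ P n * logDerivative n
      D-P zero    = trans D-1 (sym (zeroʳ 1#))
      D-P (suc n) = begin
        D (P n * (β * g))
          ≈⟨ trans (D-* _ _) (+-cong (*-congʳ (D-P n)) (*-congˡ (D-* β g))) ⟩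
        P n * r * (β * g) + P n * (D β * g + β * D g)
          ≈⟨ +-congˡ (*-congˡ (+-cong (*-congʳ (trans (D-b _) (-‿distribʳ-* _ _))) (*-congˡ (D-G _)))) ⟩
        P n * r * (β * g) + P n * (β * - l₂ * g + β * (g * l₁))
          ≈⟨ solve 6 (λ p r b g m l → p :* r :* (b :* g) :+ p :* (b :* m :* g :+ b :* (g :* l)) :=
                                      p :* (b :* g) :* (r :+ (l :+ m)))
               refl (P n) r β g (- l₂) l₁ ⟩
        P (suc n) * logDerivative (suc n) ∎
        where
        β g r l₁ l₂ : Carrier
        β = b (2 ℕ.* suc n)
        g = G (suc (2 ℕ.* n))
        r = logDerivative n
        l₁ = L (suc (2 ℕ.* n))
        l₂ = L (2 ℕ.* suc n)

      D-square : ∀ {s r} → D s ≈ s * r → D (s * s) ≈ s * s * r + s * s * r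
      D-square {s} {r} eq = begin
        D (s * s)                ≈⟨ D-* s s ⟩
        D s * s + s * D s        ≈⟨ +-cong (*-congʳ eq) (*-congˡ eq) ⟩
        s * r * s + s * (s * r)  ≈⟨ solve 2 (λ s r → s :* r :* s :+ s :* (s :* r) := s :* s :* r :+ s :* s :* r) refl s r ⟩
        s * s * r + s * s * r    ∎

-- Generating functions of `t₂` and of the divisor sums.

module ThetaSeries where

  open import Data.Integer using (ℤ; +_; -_; _+_; _-_; _*_)
  open import Data.Integer.Tactic.RingSolver using (solve-∀)
  open import Data.List using (List; []; _∷_; _++_; _∷ʳ_; map; filter; upTo; applyUpTo; concatMap; length)
  import Data.List.Properties as List
  open import Data.Nat using (_≟_)
  open import Data.Nat.ListAction using (sum)
  open import Data.Nat.ListAction.Properties using (sum-++)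
  open import Relation.Binary.PropositionalEquality
  open PowerSeries
  open Triangular

  sumFrom1-cong : ∀ n {f g} → (∀ j → 1 ≤ j → j ≤ n → f j ≡ g j) → sumFrom1 n f ≡ sumFrom1 n g
  sumFrom1-cong zero    p = refl
  sumFrom1-cong (suc n) p =
    cong₂ _+_ (sumFrom1-cong n (λ j 1≤j j≤n → p j 1≤j (ℕ.m≤n⇒m≤1+n j≤n))) (p (suc n) (s≤s z≤n) ℕ.≤-refl)

  sumFrom1-head : ∀ n f → sumFrom1 (suc n) f ≡ f 1 + sumFrom1 n (f ∘ suc)
  sumFrom1-head zero    f = ℤ.+-comm (+ 0) (f 1)
  sumFrom1-head (suc n) f = trans (cong (_+ f (suc (suc n))) (sumFrom1-head n f)) (ℤ.+-assoc (f 1) _ _)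

  sumFrom1-*ˡ : ∀ c n f → sumFrom1 n (λ j → c * f j) ≡ c * sumFrom1 n f
  sumFrom1-*ˡ c zero    f = sym (ℤ.*-zeroʳ c)
  sumFrom1-*ˡ c (suc n) f = trans (cong (_+ c * f (suc n)) (sumFrom1-*ˡ c n f)) (sym (ℤ.*-distribˡ-+ c _ _))

  sumFrom1-zero : ∀ n {f} → (∀ j → 1 ≤ j → j ≤ n → f j ≡ + 0) → sumFrom1 n f ≡ + 0
  sumFrom1-zero zero    p = refl
  sumFrom1-zero (suc n) p = cong₂ _+_ (sumFrom1-zero n (λ j 1≤j j≤n → p j 1≤j (ℕ.m≤n⇒m≤1+n j≤n))) (p (suc n) (s≤s z≤n) ℕ.≤-refl)

  sumFrom1-extend : ∀ {m n f} → m ≤ n → (∀ j → m < j → f j ≡ + 0) → sumFrom1 n f ≡ sumFrom1 m f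
  sumFrom1-extend {m} {n} {f} m≤n vanish = go (ℕ.≤⇒≤′ m≤n)
    where
    go : ∀ {n} → m ℕ.≤′ n → sumFrom1 n f ≡ sumFrom1 m f
    go ℕ.≤′-refl             = refl
    go (ℕ.≤′-step {k} m≤′k) = trans (cong₂ _+_ (go m≤′k) (vanish (suc k) (s≤s (ℕ.≤′⇒≤ m≤′k)))) (ℤ.+-identityʳ _)

  ⊛-sumFrom1 : ∀ f g n → (f ⊛ g) n ≡ f 0 * g n + sumFrom1 n (λ j → f j * g (n ∸ j))
  ⊛-sumFrom1 f g zero    = sym (ℤ.+-identityʳ _)
  ⊛-sumFrom1 f g (suc n) = cong (_+_ (f 0 * g (suc n)))
    (trans (⊛-sumFrom1 (tail f) g n) (sym (sumFrom1-head n (λ j → f j * g (suc n ∸ j)))))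

  indicator : ∀ {p} {P : Set p} → Dec P → ℤ
  indicator (yes _) = + 1
  indicator (no _)  = + 0

  indicator-yes : ∀ {p} {P : Set p} (d : Dec P) → P → indicator d ≡ + 1
  indicator-yes (yes _) _ = refl
  indicator-yes (no ¬p) p = contradiction p ¬p

  indicator-no : ∀ {p} {P : Set p} (d : Dec P) → ¬ P → indicator d ≡ + 0
  indicator-no (yes p) ¬p = contradiction p ¬p
  indicator-no (no _)  _  = refl

  indicator-⇔ : ∀ {p q} {P : Set p} {Q : Set q} (d : Dec P) (e : Dec Q) → (P → Q) → (Q → P) → indicator d ≡ indicator e
  indicator-⇔ (yes p) e to from = sym (indicator-yes e (to p))
  indicator-⇔ (no ¬p) e to from = sym (indicator-no e (¬p ∘ from))

  X^-⊛-< : ∀ {k n} f → n < k → (X^ k ⊛ f) n ≡ + 0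
  X^-⊛-< {suc k} {zero}  f _         = refl
  X^-⊛-< {suc k} {suc n} f (s≤s n<k) = trans (X^-suc-⊛ k f n) (X^-⊛-< f n<k)

  X^-⊛-+ : ∀ k f n → (X^ k ⊛ f) (k ℕ.+ n) ≡ f n
  X^-⊛-+ zero    f n = trans (const-⊛ (+ 1) f n) (ℤ.*-identityˡ (f n))
  X^-⊛-+ (suc k) f n = trans (X^-suc-⊛ k f (k ℕ.+ n)) (X^-⊛-+ k f n)

  X^-+-coefficient : ∀ k n → X^ k (k ℕ.+ n) ≡ const (+ 1) n
  X^-+-coefficient zero    n = refl
  X^-+-coefficient (suc k) n = X^-+-coefficient k n

  -- 1 / (1 - q^k)
  geometric : ℕ → Series
  geometric k n = indicator (k ∣? n)

  -- k q^k / (1 - q^k)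
  lambert : ℕ → Series
  lambert k zero    = + 0
  lambert k (suc n) = + k * indicator (k ∣? suc n)

  lambert-∤ : ∀ k n → ¬ (k ∣ n) → lambert k n ≡ + 0
  lambert-∤ k zero    _   = refl
  lambert-∤ k (suc n) k∤n = trans (cong (_*_ (+ k)) (indicator-no (k ∣? suc n) k∤n)) (ℤ.*-zeroʳ (+ k))

  lambert-∣ : ∀ k n → k ∣ suc n → lambert k (suc n) ≡ + k
  lambert-∣ k n k∣n = trans (cong (_*_ (+ k)) (indicator-yes (k ∣? suc n) k∣n)) (ℤ.*-identityʳ (+ k))

  lambert-> : ∀ k n → n < k → lambert k n ≡ + 0
  lambert-> k zero    _   = refl
  lambert-> k (suc n) n<k = lambert-∤ k (suc n) (>⇒∤ n<k)

  -- Multiplication by q^k either leaves nothing at an index or shifts a coefficient there. `above`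
  -- presents the index in the form k + n in which `X^-⊛-+` is stated.
  data Position (k : ℕ) : ℕ → Set where
    below : ∀ {i} → i < k → Position k i
    above : ∀ n → Position k (k ℕ.+ n)

  position : ∀ k i → Position k i
  position k i with k ℕ.≤? i
  ... | no k≰i  = below (ℕ.≰⇒> k≰i)
  ... | yes k≤i = subst (Position k) (ℕ.m+[n∸m]≡n k≤i) (above (i ∸ k))

  lambert-double : ∀ k m → lambert (2 ℕ.* k) (2 ℕ.* suc m) ≡ + 2 * lambert k (suc m)
  lambert-double k m = trans
    (cong₂ _*_ (ℤ.pos-* 2 k) (indicator-⇔ (2 ℕ.* k ∣? 2 ℕ.* suc m) (k ∣? suc m) (*-cancelˡ-∣ 2) (*-monoʳ-∣ 2)))
    (ℤ.*-assoc (+ 2) (+ k) _)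

  sumFrom1-divisors : ∀ n j → sumFrom1 j (λ k → lambert k (suc n)) ≡ + sum (filter (_∣? suc n) (applyUpTo suc j))
  sumFrom1-divisors n zero    = refl
  sumFrom1-divisors n (suc j) = begin
    sumFrom1 j (λ k → lambert k (suc n)) + lambert (suc j) (suc n)
      ≡⟨ cong₂ _+_ (sumFrom1-divisors n j) last ⟩
    + sum ds + + sum (filter (_∣? suc n) (suc j ∷ []))
      ≡⟨ ℤ.pos-+ (sum ds) _ ⟨
    + (sum ds ℕ.+ sum (filter (_∣? suc n) (suc j ∷ [])))
      ≡⟨ cong +_ (sum-++ ds _) ⟨
    + sum (ds ++ filter (_∣? suc n) (suc j ∷ []))
      ≡⟨ cong (λ xs → + sum xs) (List.filter-++ (_∣? suc n) (applyUpTo suc j) (suc j ∷ [])) ⟨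
    + sum (filter (_∣? suc n) (applyUpTo suc j ∷ʳ suc j))
      ≡⟨ cong (λ xs → + sum (filter (_∣? suc n) xs)) (List.applyUpTo-∷ʳ suc j) ⟩
    + sum (filter (_∣? suc n) (applyUpTo suc (suc j))) ∎
    where
    open ≡-Reasoning
    ds = filter (_∣? suc n) (applyUpTo suc j)
    last : lambert (suc j) (suc n) ≡ + sum (filter (_∣? suc n) (suc j ∷ []))
    last = go (suc j ∣? suc n)
      where
      go : Dec (suc j ∣ suc n) → lambert (suc j) (suc n) ≡ + sum (filter (_∣? suc n) (suc j ∷ []))
      go (yes d) = trans (lambert-∣ (suc j) n d)
        (cong +_ (sym (trans (cong sum (List.filter-accept (_∣? suc n) d)) (ℕ.+-identityʳ (suc j)))))
      go (no ¬d) = trans (lambert-∤ (suc j) (suc n) ¬d)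
        (cong (λ xs → + sum xs) (sym (List.filter-reject (_∣? suc n) ¬d)))

  -- Divisors of n + 1 do not exceed n + 1, so every long enough partial sum of Lambert series
  -- already has its final coefficient; a finite product suffices for the exact divisor sum.
  sumFrom1-lambert : ∀ n {m} → suc n ≤ m → sumFrom1 m (λ k → lambert k (suc n)) ≡ + σℕ (suc n)
  sumFrom1-lambert n n<m = trans (sumFrom1-extend n<m (λ k n<k → lambert-> k (suc n) n<k)) (sumFrom1-divisors n (suc n))

  -- The generating function ∑ q^(h z) over the list.
  count : ∀ {a} {A : Set a} → (A → ℕ) → List A → Series
  count h zs n = + length (filter (λ z → n ≟ h z) zs)

  X^-refl : ∀ k → X^ k k ≡ + 1
  X^-refl zero    = refl
  X^-refl (suc k) = X^-refl k

  X^-≢ : ∀ k n → n ≢ k → X^ k n ≡ + 0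
  X^-≢ zero    zero    n≢k = contradiction refl n≢k
  X^-≢ zero    (suc n) _   = refl
  X^-≢ (suc k) zero    _   = refl
  X^-≢ (suc k) (suc n) n≢k = X^-≢ k n (n≢k ∘ cong suc)

  count-∷ : ∀ {a} {A : Set a} (h : A → ℕ) z zs n → count h (z ∷ zs) n ≡ X^ (h z) n + count h zs n
  count-∷ h z zs n = go (n ≟ h z)
    where
    go : Dec (n ≡ h z) → count h (z ∷ zs) n ≡ X^ (h z) n + count h zs n
    go (yes refl) = trans (cong (λ xs → + length xs) (List.filter-accept (λ z → n ≟ h z) refl))
      (trans (ℤ.pos-+ 1 _) (cong (_+ count h zs n) (sym (X^-refl (h z)))))
    go (no n≢)    = trans (cong (λ xs → + length xs) (List.filter-reject (λ z → n ≟ h z) n≢))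
      (trans (sym (ℤ.+-identityˡ _)) (cong (_+ count h zs n) (sym (X^-≢ (h z) n n≢))))

  count-++ : ∀ {a} {A : Set a} (h : A → ℕ) xs ys n → count h (xs ++ ys) n ≡ count h xs n + count h ys n
  count-++ h xs ys n = trans
    (cong +_ (trans (cong length (List.filter-++ (λ z → n ≟ h z) xs ys)) (List.length-++ (filter (λ z → n ≟ h z) xs))))
    (ℤ.pos-+ (length (filter (λ z → n ≟ h z) xs)) _)

  pairSum : ∀ {a} {A : Set a} → (A → ℕ) → A × A → ℕ
  pairSum h xy = h (proj₁ xy) ℕ.+ h (proj₂ xy)

  count-shift : ∀ {a} {A : Set a} (h : A → ℕ) a ys n → count (pairSum h) (map (a ,_) ys) n ≡ (X^ (h a) ⊛ count h ys) n
  count-shift h a []       n = sym (trans (⊛-comm (X^ (h a)) (λ _ → + 0) n) (⊛-zeroˡ (X^ (h a)) n))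
  count-shift h a (y ∷ ys) n = begin
    count (pairSum h) (map (a ,_) (y ∷ ys)) n                        ≡⟨ count-∷ (pairSum h) (a , y) (map (a ,_) ys) n ⟩
    X^ (h a ℕ.+ h y) n + count (pairSum h) (map (a ,_) ys) n         ≡⟨ cong₂ _+_ (sym (X^-+ (h a) (h y) n)) (count-shift h a ys n) ⟩
    (X^ (h a) ⊛ X^ (h y)) n + (X^ (h a) ⊛ count h ys) n     ≡⟨ ⊛-distribˡ (X^ (h a)) (X^ (h y)) (count h ys) n ⟨
    (X^ (h a) ⊛ (X^ (h y) ⊕ count h ys)) n                  ≡⟨ ⊛-cong-≤ n (λ _ _ → refl) (λ i _ → count-∷ h y ys i) ⟨
    (X^ (h a) ⊛ count h (y ∷ ys)) n                         ∎
    where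
    open ≡-Reasoning

  -- The nested list has the shape used in `t₂`, so that the coefficients of ψ² and the values of
  -- `t₂` meet without reindexing.
  count-pairs : ∀ {a} {A : Set a} (h : A → ℕ) xs ys n → count (pairSum h) (concatMap (λ a → map (λ b → (a , b)) ys) xs) n ≡ (count h xs ⊛ count h ys) n
  count-pairs h []       ys n = sym (⊛-zeroˡ (count h ys) n)
  count-pairs h (x ∷ xs) ys n = begin
    count (pairSum h) (map (x ,_) ys ++ rest) n                       ≡⟨ count-++ (pairSum h) (map (x ,_) ys) rest n ⟩
    count (pairSum h) (map (x ,_) ys) n + count (pairSum h) rest n             ≡⟨ cong₂ _+_ (count-shift h x ys n) (count-pairs h xs ys n) ⟩
    (X^ (h x) ⊛ count h ys) n + (count h xs ⊛ count h ys) n  ≡⟨ ⊛-distribʳ (count h ys) (X^ (h x)) (count h xs) n ⟨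
    ((X^ (h x) ⊕ count h xs) ⊛ count h ys) n                 ≡⟨ ⊛-cong-≤ n (λ i _ → count-∷ h x xs i) (λ _ _ → refl) ⟨
    (count h (x ∷ xs) ⊛ count h ys) n                        ∎
    where
    open ≡-Reasoning
    rest = concatMap (λ a → map (λ b → (a , b)) ys) xs

  module Coefficients (M : ℕ) where
    open Truncated M
    open GaussProduct ring
    open CommutativeRing ring using (1#) renaming (_-_ to _⊖_)

    [1-X^]⊛ : ∀ k f {i} → i < M → ((1# ⊖ X^ k) ⊛ f) i ≡ f i - (X^ k ⊛ f) i
    [1-X^]⊛ k f {i} i<M = 1-x*y (X^ k) f i i<M

    -- Below the exponent only index 0 is a multiple of it; from there on the shift is by a full
    -- period of the indicator, and the difference vanishes.
    geometric-inverse : ∀ k → (1# ⊖ X^ (suc k)) ⊛ geometric (suc k) ≈ 1#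
    geometric-inverse k i i<M = trans ([1-X^]⊛ (suc k) (geometric (suc k)) i<M) (go i (position (suc k) i))
      where
      go : ∀ i → Position (suc k) i → geometric (suc k) i - (X^ (suc k) ⊛ geometric (suc k)) i ≡ const (+ 1) i
      go zero (below i<k) =
        cong₂ _-_ (indicator-yes (suc k ∣? 0) (suc k ∣0)) (X^-⊛-< (geometric (suc k)) i<k)
      go (suc i) (below i<k) =
        cong₂ _-_ (indicator-no (suc k ∣? suc i) (>⇒∤ i<k)) (X^-⊛-< (geometric (suc k)) i<k)
      go .(suc (k ℕ.+ n)) (above n) =
        trans (cong₂ _-_
                (indicator-⇔ (suc k ∣? (suc k ℕ.+ n)) (suc k ∣? n) (λ d → ∣m+n∣m⇒∣n d ∣-refl) (∣m∣n⇒∣m+n ∣-refl))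
                (X^-⊛-+ (suc k) (geometric (suc k)) n))
              (ℤ.+-inverseʳ (geometric (suc k) n))

    D-1-X^ : ∀ k → D (1# ⊖ X^ (suc k)) ≈ ⊝ ((1# ⊖ X^ (suc k)) ⊛ lambert (suc k))
    D-1-X^ k i i<M = trans (go i (position (suc k) i)) (cong -_ (sym ([1-X^]⊛ (suc k) (lambert (suc k)) i<M)))
      where
      l = lambert (suc k)
      go : ∀ i → Position (suc k) i → D (1# ⊖ X^ (suc k)) i ≡ - (l i - (X^ (suc k) ⊛ l) i)
      go zero    (below i<k) = refl
      go (suc i) (below i<k) = begin
        + suc i * (+ 0 - X^ k i)             ≡⟨ cong (λ x → + suc i * (+ 0 - x)) (X^-< (ℕ.≤-pred i<k)) ⟩
        + suc i * + 0                        ≡⟨ ℤ.*-zeroʳ (+ suc i) ⟩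
        + 0                                  ≡⟨ cong₂ (λ x y → - (x - y)) (lambert-> (suc k) (suc i) i<k) (X^-⊛-< l i<k) ⟨
        - (l (suc i) - (X^ (suc k) ⊛ l) (suc i)) ∎
        where open ≡-Reasoning
      go .(suc (k ℕ.+ n)) (above n) = begin
        + suc (k ℕ.+ n) * (+ 0 - X^ k (k ℕ.+ n))
          ≡⟨ cong (λ x → + suc (k ℕ.+ n) * (+ 0 - x)) (X^-+-coefficient k n) ⟩
        + suc (k ℕ.+ n) * (+ 0 - const (+ 1) n)
          ≡⟨ step n ⟩
        - (l (suc k ℕ.+ n) - l n)
          ≡⟨ cong (λ x → - (l (suc k ℕ.+ n) - x)) (X^-⊛-+ (suc k) l n) ⟨
        - (l (suc k ℕ.+ n) - (X^ (suc k) ⊛ l) (suc k ℕ.+ n)) ∎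
        where
        open ≡-Reasoning
        step : ∀ n → + suc (k ℕ.+ n) * (+ 0 - const (+ 1) n) ≡ - (l (suc k ℕ.+ n) - l n)
        -- The one index where the difference survives: the coefficient at `suc k` is `suc k`, while
        -- the one at 0 is set to 0 although every number divides 0.
        step zero rewrite ℕ.+-identityʳ k | lambert-∣ (suc k) k ∣-refl = lemma (+ suc k)
          where
          lemma : ∀ x → x * (+ 0 - + 1) ≡ - (x - + 0)
          lemma = solve-∀
        step (suc n) = begin
          + suc (k ℕ.+ suc n) * + 0        ≡⟨ ℤ.*-zeroʳ (+ suc (k ℕ.+ suc n)) ⟩
          - (+ 0)                          ≡⟨ cong -_ (ℤ.+-inverseʳ (l (suc n))) ⟨
          - (l (suc n) - l (suc n))        ≡⟨ cong (λ x → - (+ suc k * x - l (suc n)))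
                                                (indicator-⇔ (suc k ∣? suc n) (suc k ∣? (suc k ℕ.+ suc n))
                                                  (∣m∣n⇒∣m+n ∣-refl) (λ d → ∣m+n∣m⇒∣n d ∣-refl)) ⟩
          - (l (suc k ℕ.+ suc n) - l (suc n)) ∎

    D-1 : D 1# ≈ (λ _ → + 0)
    D-1 zero    _ = refl
    D-1 (suc i) _ = ℤ.*-zeroʳ (+ suc i)

    ψ : ℕ → Series
    ψ K = sum< K (λ i → X^ (tri i))

    private module Shanks = Multipliers X^ (λ _ _ → refl) (λ j k i _ → X^-+ j k i) geometric geometric-inverse
    open Shanks using (gauss; module LogDerivative)
    open LogDerivative D D-cong D-1 (λ f g i _ → D-⊛ f g i) lambert D-1-X^

    lambertSum : ℕ → Series
    lambertSum = logDerivative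

    -- The bound on M makes every q^((k+1)(2n+1)) vanish at this precision, so ψ can be exchanged
    -- for the product `P n`, differentiated there, and exchanged back through `D-cong`.
    D-ψ² : ∀ n → M ≤ suc (2 ℕ.* n) → let f = ψ (suc (2 ℕ.* n)) in
           D (f ⊛ f) ≈ f ⊛ f ⊛ lambertSum n ⊕ f ⊛ f ⊛ lambertSum n
    D-ψ² n M≤ = D-square D-ψ
      where
      open CommutativeRing ring using (*-congʳ) renaming (trans to ≈-trans; sym to ≈-sym)
      ψ≈P = gauss n (λ k i i<M → X^-< (ℕ.<-≤-trans i<M (ℕ.≤-trans M≤ (ℕ.m≤m+n _ _))))
      D-ψ : D (ψ (suc (2 ℕ.* n))) ≈ ψ (suc (2 ℕ.* n)) ⊛ lambertSum n
      D-ψ = ≈-trans (D-cong ψ≈P) (≈-trans (D-P n) (*-congʳ (≈-sym ψ≈P)))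

    -- T(K) ≥ K keeps later terms away from coefficient i. This reconciles the one fixed truncation
    -- of ψ with `t₂ n`, whose enumeration range depends on n.
    ψ-stable : ∀ {i K} → i < K → ψ K i ≡ ψ (suc i) i
    ψ-stable {i} i<K = go (ℕ.≤⇒≤′ i<K)
      where
      go : ∀ {K} → suc i ℕ.≤′ K → ψ K i ≡ ψ (suc i) i
      go ℕ.≤′-refl             = refl
      go (ℕ.≤′-step {K} i<′K) = trans
        (cong₂ _+_ (go i<′K) (X^-< (ℕ.<-≤-trans (ℕ.≤′⇒≤ i<′K) (n≤tri K)))) (ℤ.+-identityʳ _)

    ψ-upTo : ∀ K n → ψ K n ≡ count tri (upTo K) n
    ψ-upTo zero    n = refl
    ψ-upTo (suc K) n = begin
      ψ K n + X^ (tri K) n                              ≡⟨ cong₂ _+_ (ψ-upTo K n) (sym (trans (count-∷ tri K [] n) (ℤ.+-identityʳ _))) ⟩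
      count tri (upTo K) n + count tri (K ∷ []) n       ≡⟨ count-++ tri (upTo K) (K ∷ []) n ⟨
      count tri (upTo K ∷ʳ K) n                         ≡⟨ cong (λ xs → count tri xs n) (List.upTo-∷ʳ K) ⟩
      count tri (upTo (suc K)) n                        ∎
      where open ≡-Reasoning

    ψ²-t₂ : ∀ {n K} → n < K → (ψ K ⊛ ψ K) n ≡ + t₂ n
    ψ²-t₂ {n} {K} n<K = trans (⊛-cong-≤ n agree agree) (sym (count-pairs tri (upTo (suc n)) (upTo (suc n)) n))
      where
      agree : ∀ i → i ≤ n → ψ K i ≡ count tri (upTo (suc n)) i
      agree i i≤n = trans (ψ-stable (ℕ.≤-<-trans i≤n n<K)) (trans (sym (ψ-stable (s≤s i≤n))) (ψ-upTo (suc n) i))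

    -- Odd indices with sign + and even ones with sign - amount to all indices once, minus the even
    -- ones twice; the sum over all indices is what yields σ.
    lambertSum-split : ∀ n i → lambertSum n i ≡
      sumFrom1 (2 ℕ.* n) (λ k → lambert k i) - + 2 * sumFrom1 n (λ k → lambert (2 ℕ.* k) i)
    lambertSum-split zero    i = refl
    lambertSum-split (suc n) i = begin
      lambertSum n i + (lambert (suc (2 ℕ.* n)) i - lambert (2 ℕ.* suc n) i)
        ≡⟨ cong (_+ (lambert (suc (2 ℕ.* n)) i - lambert (2 ℕ.* suc n) i)) (lambertSum-split n i) ⟩
      (s - + 2 * e) + (lambert (suc (2 ℕ.* n)) i - lambert (2 ℕ.* suc n) i)
        ≡⟨ lemma s e _ _ ⟩
      (s + lambert (suc (2 ℕ.* n)) i + lambert (2 ℕ.* suc n) i) - + 2 * (e + lambert (2 ℕ.* suc n) i)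
        ≡⟨ cong (λ k → (s + lambert (suc (2 ℕ.* n)) i + lambert k i) - + 2 * (e + lambert (2 ℕ.* suc n) i)) (ℕ.*-suc 2 n) ⟩
      sumFrom1 (2 ℕ.+ 2 ℕ.* n) (λ k → lambert k i) - + 2 * (e + lambert (2 ℕ.* suc n) i)
        ≡⟨ cong (λ m → sumFrom1 m (λ k → lambert k i) - + 2 * (e + lambert (2 ℕ.* suc n) i)) (ℕ.*-suc 2 n) ⟨
      sumFrom1 (2 ℕ.* suc n) (λ k → lambert k i) - + 2 * sumFrom1 (suc n) (λ k → lambert (2 ℕ.* k) i) ∎
      where
      open ≡-Reasoning
      s = sumFrom1 (2 ℕ.* n) (λ k → lambert k i)
      e = sumFrom1 n (λ k → lambert (2 ℕ.* k) i)
      lemma : ∀ s e x y → (s - + 2 * e) + (x - y) ≡ (s + x + y) - + 2 * (e + y)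
      lemma = solve-∀

    lambertSum-odd : ∀ n m → suc (2 ℕ.* m) ≤ 2 ℕ.* n → lambertSum n (suc (2 ℕ.* m)) ≡ + σℕ (suc (2 ℕ.* m))
    lambertSum-odd n m ≤n = begin
      lambertSum n (suc (2 ℕ.* m))    ≡⟨ lambertSum-split n (suc (2 ℕ.* m)) ⟩
      sumFrom1 (2 ℕ.* n) (λ k → lambert k (suc (2 ℕ.* m))) - + 2 * sumFrom1 n (λ k → lambert (2 ℕ.* k) (suc (2 ℕ.* m)))
        ≡⟨ cong₂ (λ x y → x - + 2 * y) (sumFrom1-lambert (2 ℕ.* m) ≤n)
             (sumFrom1-zero n (λ k _ _ → lambert-∤ (2 ℕ.* k) (suc (2 ℕ.* m)) (λ d → 2∤odd m (∣-trans (m∣m*n k) d)))) ⟩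
      + σℕ (suc (2 ℕ.* m)) - + 0      ≡⟨ ℤ.+-identityʳ _ ⟩
      + σℕ (suc (2 ℕ.* m))            ∎
      where open ≡-Reasoning

    -- The 4 is 2 · 2: one factor from the sign change of the even indices in `lambertSum-split`,
    -- the other because the even divisors of 2(m+1) are the doubles of the divisors of m + 1.
    lambertSum-even : ∀ n m → suc m ≤ n → lambertSum n (2 ℕ.* suc m) ≡ + σℕ (2 ℕ.* suc m) - + 4 * + σℕ (suc m)
    lambertSum-even n m m<n = begin
      lambertSum n (2 ℕ.* suc m)    ≡⟨ lambertSum-split n (2 ℕ.* suc m) ⟩
      sumFrom1 (2 ℕ.* n) (λ k → lambert k (2 ℕ.* suc m)) - + 2 * sumFrom1 n (λ k → lambert (2 ℕ.* k) (2 ℕ.* suc m))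
        ≡⟨ cong₂ (λ x y → x - + 2 * y) (sumFrom1-lambert _ (ℕ.*-monoʳ-≤ 2 m<n)) double ⟩
      + σℕ (2 ℕ.* suc m) - + 2 * (+ 2 * + σℕ (suc m))
        ≡⟨ cong (_-_ (+ σℕ (2 ℕ.* suc m))) (ℤ.*-assoc (+ 2) (+ 2) (+ σℕ (suc m))) ⟨
      + σℕ (2 ℕ.* suc m) - + 4 * + σℕ (suc m) ∎
      where
      open ≡-Reasoning
      double : sumFrom1 n (λ k → lambert (2 ℕ.* k) (2 ℕ.* suc m)) ≡ + 2 * + σℕ (suc m)
      double = begin
        sumFrom1 n (λ k → lambert (2 ℕ.* k) (2 ℕ.* suc m)) ≡⟨ sumFrom1-cong n (λ k _ _ → lambert-double k m) ⟩
        sumFrom1 n (λ k → + 2 * lambert k (suc m))         ≡⟨ sumFrom1-*ˡ (+ 2) n _ ⟩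
        + 2 * sumFrom1 n (λ k → lambert k (suc m))         ≡⟨ cong (_*_ (+ 2)) (sumFrom1-lambert m m<n) ⟩
        + 2 * + σℕ (suc m)                                 ∎

-- Parity of finite sets under involutions.

module TwoSquares where

  open import Data.List using (List; []; _∷_; _++_; map; filter; upTo; concatMap; length; cartesianProduct)
  open import Data.List.Membership.Propositional using (_∈_; find; lose)
  open import Data.List.Membership.Propositional.Properties
  open import Data.List.Relation.Binary.Permutation.Propositional using (_↭_; ↭-sym; ↭⇒↭ₛ)
  import Data.List.Relation.Binary.Permutation.Propositional.Properties as ↭
  open import Data.List.Relation.Binary.Permutation.Setoid.Properties using (Unique-resp-↭)
  open import Data.List.Relation.Unary.All using (_∷_)
  import Data.List.Relation.Unary.All as All
  open import Data.List.Relation.Unary.AllPairs using (_∷_)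
  open import Data.List.Relation.Unary.Any using (here; there; any?)
  open import Data.List.Relation.Unary.Unique.Propositional using (Unique)
  import Data.List.Relation.Unary.Unique.Propositional.Properties as Unique
  open import Data.Nat
  open import Data.Nat.Primality using (euclidsLemma; prime⇒nonZero)
  open import Data.Nat.Properties
  open import Data.Nat.Tactic.RingSolver using (solve-∀)
  open import Relation.Binary.Definitions using (tri<; tri≈; tri>)
  open import Relation.Binary.PropositionalEquality
  open Triangular

  module _ {a} {A : Set a} where

    unique-extract : ∀ {x : A} {xs} → x ∈ xs → Unique xs → ∃[ ys ] xs ↭ x ∷ ys × Unique (x ∷ ys)
    unique-extract x∈xs unique with ∈-∃++ x∈xs
    ... | ys , zs , refl = ys ++ zs , ↭.shift _ ys zs , Unique-resp-↭ (setoid A) (↭⇒↭ₛ (↭.shift _ ys zs)) unique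

    module _ (f : A → A) where

      -- Removing x together with f x leaves a set on which f still acts, because an involution is
      -- injective. The remainder is known only up to permutation, hence the recursion on a bound
      -- for the length.
      fixed-point-free⇒even-length : ∀ xs → Unique xs → (∀ {x} → x ∈ xs → f x ∈ xs) →
        (∀ {x} → x ∈ xs → f (f x) ≡ x) → (∀ {x} → x ∈ xs → f x ≢ x) → 2 ∣ length xs
      fixed-point-free⇒even-length xs = go (length xs) xs ≤-refl
        where
        go : ∀ n xs → length xs ≤ n → Unique xs → (∀ {x} → x ∈ xs → f x ∈ xs) →
             (∀ {x} → x ∈ xs → f (f x) ≡ x) → (∀ {x} → x ∈ xs → f x ≢ x) → 2 ∣ length xs
        go n       []       _       _              _      _     _    = 2 ∣0
        go (suc n) (x ∷ xs) (s≤s l) (x∉xs ∷ uniq) closed invol free with closed (here refl)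
        ... | here fx≡x   = contradiction fx≡x (free (here refl))
        ... | there fx∈xs with unique-extract fx∈xs uniq
        ...   | ys , xs↭ , (fx∉ys ∷ uniq-ys) =
          subst (2 ∣_) (cong suc (sym len)) (∣m∣n⇒∣m+n ∣-refl (go n ys ys≤n uniq-ys closed-ys (invol ∘ there ∘ weaken) (free ∘ there ∘ weaken)))
          where
          len : length xs ≡ suc (length ys)
          len = ↭.↭-length xs↭
          ys≤n : length ys ≤ n
          ys≤n = ≤-trans (n≤1+n _) (subst (_≤ n) len l)
          weaken : ∀ {y} → y ∈ ys → y ∈ xs
          weaken y∈ys = ↭.∈-resp-↭ (↭-sym xs↭) (there y∈ys)
          closed-ys : ∀ {y} → y ∈ ys → f y ∈ ys
          closed-ys {y} y∈ys with closed (there (weaken y∈ys))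
          ... | here fy≡x   = contradiction (trans (cong f (sym fy≡x)) (invol (there (weaken y∈ys)))) (All.lookup fx∉ys y∈ys)
          ... | there fy∈xs with ↭.∈-resp-↭ xs↭ fy∈xs
          ...   | here fy≡fx  = contradiction (trans (sym (invol (here refl))) (trans (cong f (sym fy≡fx)) (invol (there (weaken y∈ys))))) (All.lookup x∉xs (weaken y∈ys))
          ...   | there fy∈ys = fy∈ys

      unique-fixed-point⇒odd-length : ∀ xs x₀ → Unique xs → (∀ {x} → x ∈ xs → f x ∈ xs) →
        (∀ {x} → x ∈ xs → f (f x) ≡ x) → x₀ ∈ xs → f x₀ ≡ x₀ → (∀ {x} → x ∈ xs → f x ≡ x → x ≡ x₀) →
        ¬ 2 ∣ length xs
      unique-fixed-point⇒odd-length xs x₀ uniq closed invol x₀∈xs fixed only even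
        with unique-extract x₀∈xs uniq
      ... | ys , xs↭ , (x₀∉ys ∷ uniq-ys) =
        contradiction (∣1⇒≡1 (∣m+n∣m⇒∣n (subst (2 ∣_) (trans (↭.↭-length xs↭) (+-comm 1 _)) even)
          (fixed-point-free⇒even-length ys uniq-ys closed-ys (invol ∘ weaken)
            (λ y∈ys fy≡y → All.lookup x₀∉ys y∈ys (sym (only (weaken y∈ys) fy≡y)))))) (λ ())
        where
        weaken : ∀ {y} → y ∈ ys → y ∈ xs
        weaken y∈ys = ↭.∈-resp-↭ (↭-sym xs↭) (there y∈ys)
        closed-ys : ∀ {y} → y ∈ ys → f y ∈ ys
        closed-ys y∈ys with ↭.∈-resp-↭ xs↭ (closed (weaken y∈ys))
        ... | here fy≡x₀  = contradiction (trans (sym fixed) (trans (cong f (sym fy≡x₀)) (invol (weaken y∈ys)))) (All.lookup x₀∉ys y∈ys)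
        ... | there fy∈ys = fy∈ys

  prime≢square : ∀ {q} → Prime q → ∀ s → s * s ≢ q
  prime≢square pr s refl with prime⇒irreducible pr (m∣m*n {s} s)
  ... | inj₁ refl = ¬prime[1] pr
  ... | inj₂ s≡s² = ¬prime[1] (subst Prime (trans (sym s≡s²) s≡1) pr)
    where
    instance _ = m*n≢0⇒m≢0 s {{prime⇒nonZero pr}}
    s≡1 : s ≡ 1
    s≡1 = *-cancelˡ-≡ s 1 s (trans (sym s≡s²) (sym (*-identityʳ s)))

  -- Zagier's involution and the existence of a representation by two squares.

  Triple : Set
  Triple = ℕ × ℕ × ℕ

  form : Triple → ℕ
  form (x , y , z) = x * x + 4 * (y * z)

  -- Zagier's involution on the solutions of x² + 4yz = q; on each branch the guards
  -- ensure that the subtractions do not truncate.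
  zagierA zagierB zagierC zagier : Triple → Triple
  zagierA (x , y , z) = x + 2 * z , z , y ∸ (x + z)
  zagierB (x , y , z) = 2 * y ∸ x , y , (x + z) ∸ y
  zagierC (x , y , z) = x ∸ 2 * y , (x + z) ∸ y , y
  zagier t@(x , y , z) with x + z <? y | x <? 2 * y
  ... | yes _ | _     = zagierA t
  ... | no _  | yes _ = zagierB t
  ... | no _  | no _  = zagierC t

  zagier-A : ∀ {x y z} → x + z < y → zagier (x , y , z) ≡ zagierA (x , y , z)
  zagier-A {x} {y} {z} p with x + z <? y | x <? 2 * y
  ... | yes _ | _ = refl
  ... | no ¬p | _ = contradiction p ¬p

  zagier-B : ∀ {x y z} → y ≤ x + z → x < 2 * y → zagier (x , y , z) ≡ zagierB (x , y , z)
  zagier-B {x} {y} {z} p r with x + z <? y | x <? 2 * y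
  ... | yes ¬p | _     = contradiction p (<⇒≱ ¬p)
  ... | no _   | yes _ = refl
  ... | no _   | no ¬r = contradiction r ¬r

  zagier-C : ∀ {x y z} → y ≤ x + z → 2 * y ≤ x → zagier (x , y , z) ≡ zagierC (x , y , z)
  zagier-C {x} {y} {z} p r with x + z <? y | x <? 2 * y
  ... | yes ¬p | _     = contradiction p (<⇒≱ ¬p)
  ... | no _   | yes ¬r = contradiction r (<⇒≱ ¬r)
  ... | no _   | no _  = refl

  -- The branches of `zagier` with strict inequalities and with the differences named, so that
  -- truncated subtraction disappears. The boundaries carry no solution: y = x + z makes the form a
  -- square, x = 2y makes it even.
  data Region (x y z : ℕ) : Set where
    A : ∀ d → y ≡ x + z + d → 0 < d → Region x y z
    B : ∀ c d → 2 * y ≡ x + c → x + z ≡ y + d → 0 < c → 0 < d → Region x y z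
    C : ∀ c → x ≡ 2 * y + c → 0 < c → Region x y z

  module Zagier (q : ℕ) (prime : Prime q) (odd : ¬ 2 ∣ q) where

    x-positive : ∀ x y z → form (x , y , z) ≡ q → 0 < x
    x-positive (suc _) y z _   = s≤s z≤n
    x-positive zero y z sol = contradiction (subst (2 ∣_) sol (∣m⇒∣m*n (y * z) (divides 2 refl))) odd

    y-positive : ∀ x y z → form (x , y , z) ≡ q → 0 < y
    y-positive x (suc _) z _   = s≤s z≤n
    y-positive x zero z sol = contradiction (trans (sym (+-identityʳ (x * x))) sol) (prime≢square prime x)

    z-positive : ∀ x y z → form (x , y , z) ≡ q → 0 < z
    z-positive x y (suc _) _   = s≤s z≤n
    z-positive x y zero sol = contradiction
      (trans (sym (trans (cong (λ t → x * x + 4 * t) (*-zeroʳ y)) (+-identityʳ (x * x)))) sol) (prime≢square prime x)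

    module _ (x y z : ℕ) (sol : form (x , y , z) ≡ q) where

      y≢x+z : y ≢ x + z
      y≢x+z refl = prime≢square prime (x + 2 * z) (trans (lemma x z) sol)
        where
        lemma : ∀ x z → (x + 2 * z) * (x + 2 * z) ≡ x * x + 4 * ((x + z) * z)
        lemma = solve-∀

      x≢2y : x ≢ 2 * y
      x≢2y refl = odd (subst (2 ∣_) sol (divides (2 * (y * y) + 2 * (y * z)) (lemma y z)))
        where
        lemma : ∀ y z → 2 * y * (2 * y) + 4 * (y * z) ≡ (2 * (y * y) + 2 * (y * z)) * 2
        lemma = solve-∀

      region : Region x y z
      region with x + z <? y | x <? 2 * y
      ... | yes p | _     = A (y ∸ (x + z)) (sym (m+[n∸m]≡n (<⇒≤ p))) (m<n⇒0<n∸m p)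
      ... | no ¬p | yes r = B (2 * y ∸ x) (x + z ∸ y) (sym (m+[n∸m]≡n (<⇒≤ r))) (sym (m+[n∸m]≡n (≮⇒≥ ¬p)))
                              (m<n⇒0<n∸m r) (m<n⇒0<n∸m (≤∧≢⇒< (≮⇒≥ ¬p) y≢x+z))
      ... | no ¬p | no ¬r = C (x ∸ 2 * y) (sym (m+[n∸m]≡n (≮⇒≥ ¬r))) (m<n⇒0<n∸m (≤∧≢⇒< (≮⇒≥ ¬r) (x≢2y ∘ sym)))

    evalA : ∀ x z {d} → 0 < d → zagier (x , x + z + d , z) ≡ (x + 2 * z , z , d)
    evalA x z {d} 0<d = trans (zagier-A (m<m+n (x + z) 0<d)) (cong (λ t → x + 2 * z , z , t) (m+n∸m≡n (x + z) d))

    evalB : ∀ x y z {c d} → 2 * y ≡ x + c → x + z ≡ y + d → 0 < c → zagier (x , y , z) ≡ (c , y , d)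
    evalB x y z {c} {d} p r 0<c = trans
      (zagier-B (≤-trans (m≤m+n y d) (≤-reflexive (sym r))) (≤-trans (m<m+n x 0<c) (≤-reflexive (sym p))))
      (cong₂ (λ s t → s , y , t) (trans (cong (_∸ x) p) (m+n∸m≡n x c)) (trans (cong (_∸ y) r) (m+n∸m≡n y d)))

    evalC : ∀ y z c → zagier (2 * y + c , y , z) ≡ (c , c + y + z , y)
    evalC y z c = trans (zagier-C (≤-trans (m≤m+n y _) (≤-reflexive (sym (lemma y z c)))) (m≤m+n (2 * y) c))
      (cong₂ (λ s t → s , t , y) (m+n∸m≡n (2 * y) c) (trans (cong (_∸ y) (lemma y z c)) (m+n∸m≡n y _)))
      where
      lemma : ∀ y z c → 2 * y + c + z ≡ y + (c + y + z)
      lemma = solve-∀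

    zagier-form : ∀ t → form t ≡ q → form (zagier t) ≡ q
    zagier-form (x , y , z) sol with region x y z sol
    ... | A d refl 0<d = trans (cong form (evalA x z 0<d)) (trans (lemma x z d) sol)
      where
      lemma : ∀ x z d → (x + 2 * z) * (x + 2 * z) + 4 * (z * d) ≡ x * x + 4 * ((x + z + d) * z)
      lemma = solve-∀
    ... | C c refl 0<c = trans (cong form (evalC y z c)) (trans (lemma y z c) sol)
      where
      lemma : ∀ y z c → c * c + 4 * ((c + y + z) * y) ≡ (2 * y + c) * (2 * y + c) + 4 * (y * z)
      lemma = solve-∀
    -- The identity (2y-x)² + 4y(x+z-y) = x² + 4yz, freed of subtraction: adding 2x(2y) + (2y)² on
    -- both sides lets the relations for x + c and y + d be substituted.
    ... | B c d p r 0<c 0<d = trans (cong form (evalB x y z p r 0<c)) (trans (+-cancelʳ-≡ (2 * (x * (2 * y)) + 2 * y * (2 * y)) _ _ (begin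
        c * c + 4 * (y * d) + (2 * (x * (2 * y)) + 2 * y * (2 * y))  ≡⟨ lemma₁ x y c d ⟩
        c * c + 2 * (x * (2 * y)) + 4 * (y * (y + d))                ≡⟨ cong₂ (λ s t → c * c + 2 * (x * s) + 4 * (y * t)) p (sym r) ⟩
        c * c + 2 * (x * (x + c)) + 4 * (y * (x + z))                ≡⟨ lemma₂ x y z c ⟩
        x * x + 4 * (y * z) + (2 * (x * (2 * y)) + (x + c) * (x + c)) ≡⟨ cong (λ s → x * x + 4 * (y * z) + (2 * (x * (2 * y)) + s * s)) p ⟨
        x * x + 4 * (y * z) + (2 * (x * (2 * y)) + 2 * y * (2 * y))  ∎)) sol)
      where
      open ≡-Reasoning
      lemma₁ : ∀ x y c d → c * c + 4 * (y * d) + (2 * (x * (2 * y)) + 2 * y * (2 * y)) ≡ c * c + 2 * (x * (2 * y)) + 4 * (y * (y + d))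
      lemma₁ = solve-∀
      lemma₂ : ∀ x y z c → c * c + 2 * (x * (x + c)) + 4 * (y * (x + z)) ≡ x * x + 4 * (y * z) + (2 * (x * (2 * y)) + (x + c) * (x + c))
      lemma₂ = solve-∀

    -- Regions A and C are exchanged and B is kept. The data of the old region serve as witnesses
    -- for the new one; positivity of the coordinates supplies its strict inequalities.
    zagier-involutive : ∀ t → form t ≡ q → zagier (zagier t) ≡ t
    zagier-involutive (x , y , z) sol with region x y z sol
    ... | A d refl 0<d = trans (cong zagier (evalA x z 0<d))
      (trans (cong (λ s → zagier (s , z , d)) (+-comm x (2 * z)))
      (trans (evalC z d x) refl))
    ... | C c refl 0<c = trans (cong zagier (evalC y z c))
      (trans (evalA c y (z-positive x y z sol)) (cong (λ s → s , y , z) (+-comm c (2 * y))))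
    ... | B c d p r 0<c 0<d = trans (cong zagier (evalB x y z p r 0<c))
      (evalB c y d (trans p (+-comm x c)) (+-cancelˡ-≡ (x + y) (c + d) (y + z) (begin
        x + y + (c + d)      ≡⟨ lemma₁ x y c d ⟩
        (x + c) + (y + d)    ≡⟨ cong₂ _+_ (sym p) (sym r) ⟩
        2 * y + (x + z)      ≡⟨ lemma₂ x y z ⟩
        x + y + (y + z)      ∎)) (x-positive x y z sol))
      where
      open ≡-Reasoning
      lemma₁ : ∀ x y c d → x + y + (c + d) ≡ (x + c) + (y + d)
      lemma₁ = solve-∀
      lemma₂ : ∀ x y z → 2 * y + (x + z) ≡ x + y + (y + z)
      lemma₂ = solve-∀

    -- A fixed point can only lie in B, where c = x forces y = x. Then q = x (x + 4z) with x + 4z >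
    -- 1, and primality leaves x = 1.
    zagier-fixed : ∀ t → form t ≡ q → zagier t ≡ t → ∃[ z ] t ≡ (1 , 1 , z)
    zagier-fixed (x , y , z) sol fixed with region x y z sol
    ... | A d refl 0<d = contradiction (+-cancelˡ-≡ x (2 * z) 0
        (trans (cong proj₁ (trans (sym (evalA x z 0<d)) fixed)) (sym (+-identityʳ x)))) (m<n⇒n≢0 (≤-trans (z-positive x y z sol) (m≤m+n z _)))
    ... | C c refl 0<c = contradiction (+-cancelʳ-≡ c 0 (2 * y)
        (cong proj₁ (trans (sym (evalC y z c)) fixed))) (m<n⇒n≢0 (≤-trans (y-positive x y z sol) (m≤m+n y _)) ∘ sym)
    ... | B c d p r 0<c 0<d = z , cong₂ (λ s t → s , t , z) x≡1 (trans y≡x x≡1)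
      where
      c≡x : c ≡ x
      c≡x = cong proj₁ (trans (sym (evalB x y z p r 0<c)) fixed)
      y≡x : y ≡ x
      y≡x = *-cancelˡ-≡ y x 2 (trans p (trans (cong (x +_) c≡x) (cong (x +_) (sym (+-identityʳ x)))))
      factored : x * (x + 4 * z) ≡ q
      factored = trans (lemma x z) (trans (cong (λ s → x * x + 4 * (s * z)) (sym y≡x)) sol)
        where
        lemma : ∀ x z → x * (x + 4 * z) ≡ x * x + 4 * (x * z)
        lemma = solve-∀
      x≡1 : x ≡ 1
      x≡1 with prime⇒irreducible prime (subst (x ∣_) factored (m∣m*n (x + 4 * z)))
      ... | inj₁ x≡1 = x≡1
      ... | inj₂ x≡q = contradiction (*-cancelˡ-≡ (x + 4 * z) 1 x {{>-nonZero (x-positive x y z sol)}}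
            (trans factored (trans (sym x≡q) (sym (*-identityʳ x))))) (>⇒≢ (+-mono-≤ (x-positive x y z sol) (≤-trans (z-positive x y z sol) (m≤m+n z _))))

    triples solutions : List Triple
    triples   = cartesianProduct (upTo (suc q)) (cartesianProduct (upTo (suc q)) (upTo (suc q)))
    solutions = filter (λ t → form t ≟ q) triples

    solutions-unique : Unique solutions
    solutions-unique = Unique.filter⁺ (λ t → form t ≟ q)
      (Unique.cartesianProduct⁺ (Unique.upTo⁺ (suc q)) (Unique.cartesianProduct⁺ (Unique.upTo⁺ (suc q)) (Unique.upTo⁺ (suc q))))

    ∈-solutions⁻ : ∀ {t} → t ∈ solutions → form t ≡ q
    ∈-solutions⁻ t∈ = proj₂ (∈-filter⁻ (λ t → form t ≟ q) {xs = triples} t∈)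

    ∈-solutions⁺ : ∀ t → form t ≡ q → t ∈ solutions
    ∈-solutions⁺ (x , y , z) sol = ∈-filter⁺ (λ t → form t ≟ q)
      (∈-cartesianProduct⁺ (∈-upTo⁺ (s≤s x≤q)) (∈-cartesianProduct⁺ (∈-upTo⁺ (s≤s y≤q)) (∈-upTo⁺ (s≤s z≤q)))) sol
      where
      yz≤q : y * z ≤ q
      yz≤q = ≤-trans (m≤m+n (y * z) _) (≤-trans (m≤n+m (4 * (y * z)) (x * x)) (≤-reflexive sol))
      x≤q : x ≤ q
      x≤q = ≤-trans (m≤m*n x x {{>-nonZero (x-positive x y z sol)}}) (≤-trans (m≤m+n (x * x) _) (≤-reflexive sol))
      y≤q : y ≤ q
      y≤q = ≤-trans (m≤m*n y z {{>-nonZero (z-positive x y z sol)}}) yz≤q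
      z≤q : z ≤ q
      z≤q = ≤-trans (m≤n*m z y {{>-nonZero (y-positive x y z sol)}}) yz≤q

    swap : Triple → Triple
    swap (x , y , z) = x , z , y

    swap-form : ∀ t → form (swap t) ≡ form t
    swap-form (x , y , z) = cong (λ s → x * x + 4 * s) (*-comm z y)

    -- Two involutions on one finite set: (1, 1, p) is the only fixed point of `zagier`, so the
    -- number of solutions is odd, and the exchange of y and z must fix one too. There 4yz becomes
    -- (2y)².
    swap-fixed-point : ∀ p → q ≡ 4 * p + 1 → ∃₂ λ x y → x * x + 4 * (y * y) ≡ q
    swap-fixed-point p q≡ with any? (λ t → proj₁ (proj₂ t) ≟ proj₂ (proj₂ t)) solutions
    ... | yes found with find found
    ...   | (x , y , .y) , t∈ , refl = x , y , ∈-solutions⁻ t∈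
    swap-fixed-point p q≡ | no none = contradiction
      (fixed-point-free⇒even-length swap solutions solutions-unique
        (λ {t} t∈ → ∈-solutions⁺ (swap t) (trans (swap-form t) (∈-solutions⁻ t∈))) (λ _ → refl)
        (λ t∈ fixed → none (lose t∈ (sym (cong (proj₁ ∘ proj₂) fixed)))))
      (unique-fixed-point⇒odd-length zagier solutions (1 , 1 , p) solutions-unique
        (λ {t} t∈ → ∈-solutions⁺ (zagier t) (zagier-form t (∈-solutions⁻ t∈))) (λ {t} t∈ → zagier-involutive t (∈-solutions⁻ t∈))
        (∈-solutions⁺ (1 , 1 , p) base) (evalB 1 1 p refl refl (s≤s z≤n))
        (λ {t} t∈ fixed → is-base (∈-solutions⁻ t∈) (zagier-fixed t (∈-solutions⁻ t∈) fixed)))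
      where
      base : form (1 , 1 , p) ≡ q
      base = trans (lemma p) (sym q≡)
        where
        lemma : ∀ p → 1 * 1 + 4 * (1 * p) ≡ 4 * p + 1
        lemma = solve-∀
      is-base : ∀ {t} → form t ≡ q → ∃[ z ] t ≡ (1 , 1 , z) → t ≡ (1 , 1 , p)
      is-base sol (z , refl) = cong (λ s → 1 , 1 , s) (*-cancelˡ-≡ z p 4 (+-cancelˡ-≡ 1 (4 * z) (4 * p)
        (trans (trans (cong (λ s → 1 + 4 * s) (sym (*-identityˡ z))) sol) (trans q≡ (+-comm (4 * p) 1)))))

  -- Uniqueness of the representation of a prime by two squares.

  square-injective : ∀ m n → m * m ≡ n * n → m ≡ n
  square-injective m n eq with <-cmp m n
  ... | tri< m<n _ _ = contradiction eq (<⇒≢ (*-mono-< m<n m<n))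
  ... | tri≈ _ m≡n _ = m≡n
  ... | tri> _ _ n<m = contradiction eq (>⇒≢ (*-mono-< n<m n<m))

  x²+y²≡2xy⇒x≡y : ∀ x y → x * x + y * y ≡ 2 * (x * y) → x ≡ y
  x²+y²≡2xy⇒x≡y x y eq = [ (λ x≤y → go x≤y eq) , (λ y≤x → sym (go y≤x (trans (+-comm (y * y) (x * x)) (trans eq (cong (2 *_) (*-comm x y)))))) ]′ (≤-total x y)
    where
    go : ∀ {x y} → x ≤ y → x * x + y * y ≡ 2 * (x * y) → x ≡ y
    go {x} {y} x≤y eq = trans (sym (+-identityʳ x)) (trans (cong (x +_) (sym e≡0)) (m+[n∸m]≡n x≤y))
      where
      e = y ∸ x
      lemma : ∀ x e → x * x + (x + e) * (x + e) ≡ 2 * (x * (x + e)) + e * e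
      lemma = solve-∀
      e≡0 : e ≡ 0
      e≡0 = square-injective e 0 (+-cancelˡ-≡ (2 * (x * y)) _ _ (trans
        (subst (λ y′ → 2 * (x * y′) + e * e ≡ x * x + y′ * y′) (m+[n∸m]≡n x≤y) (sym (lemma x e)))
        (trans eq (sym (+-identityʳ _)))))

  module _ {q : ℕ} (prime : Prime q) where

    private instance
      q-nonZero : NonZero q
      q-nonZero = prime⇒nonZero prime

    summand-positive : ∀ a b → a * a + b * b ≡ q → 0 < b
    summand-positive a (suc b) _  = s≤s z≤n
    summand-positive a zero    eq = contradiction (trans (sym (+-identityʳ (a * a))) eq) (prime≢square prime a)

    summand² : ∀ a b → a * a + b * b ≡ q → a * a < q
    summand² a b eq = <-≤-trans (m<m+n (a * a) (*-mono-< b>0 b>0)) (≤-reflexive eq)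
      where b>0 = summand-positive a b eq

    two-squares-swap : ∀ a b → a * a + b * b ≡ q → b * b + a * a ≡ q
    two-squares-swap a b eq = trans (+-comm (b * b) (a * a)) eq

    cross-< : ∀ a b c d → a * a + b * b ≡ q → c * c + d * d ≡ q → a * c < q
    cross-< a b c d ab cd = [ (λ a≤c → ≤-<-trans (*-monoˡ-≤ c a≤c) (summand² c d cd))
                                    , (λ c≤a → ≤-<-trans (*-monoʳ-≤ a c≤a) (summand² a b ab)) ]′ (≤-total a c)

    proportional : ∀ a b c d → a * a + b * b ≡ q → c * c + d * d ≡ q → a * d ≡ b * c → a ≡ c
    proportional a b c d ab cd ad≡bc = square-injective a c (*-cancelʳ-≡ (a * a) (c * c) q (begin
      a * a * q                          ≡⟨ cong (a * a *_) cd ⟨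
      a * a * (c * c + d * d)            ≡⟨ lemma₁ a c d ⟩
      a * c * (a * c) + a * d * (a * d)  ≡⟨ cong (λ t → a * c * (a * c) + t * t) ad≡bc ⟩
      a * c * (a * c) + b * c * (b * c)  ≡⟨ lemma₂ a b c ⟩
      c * c * (a * a + b * b)            ≡⟨ cong (c * c *_) ab ⟩
      c * c * q                          ∎))
      where
      open ≡-Reasoning
      lemma₁ : ∀ a c d → a * a * (c * c + d * d) ≡ a * c * (a * c) + a * d * (a * d)
      lemma₁ = solve-∀
      lemma₂ : ∀ a b c → a * c * (a * c) + b * c * (b * c) ≡ c * c * (a * a + b * b)
      lemma₂ = solve-∀

    q∣m<2q⇒m≡q : ∀ {m} → q ∣ m → 0 < m → m < q + q → m ≡ q
    q∣m<2q⇒m≡q (divides zero refl)          0<m m<2q = contradiction 0<m λ ()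
    q∣m<2q⇒m≡q (divides (suc zero) eq)      0<m m<2q = trans eq (*-identityˡ q)
    q∣m<2q⇒m≡q (divides (suc (suc r)) refl) 0<m m<2q =
      contradiction m<2q (≤⇒≯ (≤-trans (m≤m+n (q + q) (r * q)) (≤-reflexive (+-assoc q q (r * q)))))

    -- Here k is ad - bc. If q divides k, then k ≤ ad < q gives k = 0. If q divides ad + bc, then 0
    -- < ad + bc < 2q gives ad + bc = q, and (ac - bd)² + (ad + bc)² = q² leaves ac = bd. Either way
    -- the two pairs are proportional, up to exchanging c and d.
    unique-from-cross : ∀ a b c d {k} → a * a + b * b ≡ q → c * c + d * d ≡ q → a * d ≡ b * c + k → a ≡ c ⊎ a ≡ d
    unique-from-cross a b c d {k} ab cd ad≡ = go (euclidsLemma k (k + 2 * (b * c)) prime q∣product)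
      where
      open ≡-Reasoning
      q∣product : q ∣ k * (k + 2 * (b * c))
      q∣product = ∣m+n∣m⇒∣n (subst (q ∣_) (begin
        a * a * q                                        ≡⟨ cong (a * a *_) cd ⟨
        a * a * (c * c + d * d)                          ≡⟨ lemma₁ a c d ⟩
        a * c * (a * c) + a * d * (a * d)                ≡⟨ cong (λ t → a * c * (a * c) + t * t) ad≡ ⟩
        a * c * (a * c) + (b * c + k) * (b * c + k)      ≡⟨ lemma₂ a b c k ⟩
        c * c * (a * a + b * b) + k * (k + 2 * (b * c))  ≡⟨ cong (λ t → c * c * t + k * (k + 2 * (b * c))) ab ⟩
        c * c * q + k * (k + 2 * (b * c))                ∎) (n∣m*n (a * a))) (n∣m*n (c * c))
        where
        lemma₁ : ∀ a c d → a * a * (c * c + d * d) ≡ a * c * (a * c) + a * d * (a * d)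
        lemma₁ = solve-∀
        lemma₂ : ∀ a b c k → a * c * (a * c) + (b * c + k) * (b * c + k) ≡ c * c * (a * a + b * b) + k * (k + 2 * (b * c))
        lemma₂ = solve-∀
      ad<q : a * d < q
      ad<q = cross-< a b d c ab (two-squares-swap c d cd)
      bc<q : b * c < q
      bc<q = cross-< b a c d (two-squares-swap a b ab) cd
      ad+bc : k + 2 * (b * c) ≡ a * d + b * c
      ad+bc = trans (lemma (b * c) k) (cong (_+ b * c) (sym ad≡))
        where
        lemma : ∀ x k → k + 2 * x ≡ (x + k) + x
        lemma = solve-∀
      go : q ∣ k ⊎ q ∣ k + 2 * (b * c) → a ≡ c ⊎ a ≡ d
      go (inj₁ q∣k) = small k ad≡ q∣k
        where
        small : ∀ k → a * d ≡ b * c + k → q ∣ k → a ≡ c ⊎ a ≡ d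
        small zero    ad≡bc _     = inj₁ (proportional a b c d ab cd (trans ad≡bc (+-identityʳ (b * c))))
        small (suc k) ad≡bc+k q∣k = contradiction ad<q
          (≤⇒≯ (≤-trans (∣⇒≤ q∣k) (≤-trans (m≤n+m (suc k) (b * c)) (≤-reflexive (sym ad≡bc+k)))))
      go (inj₂ q∣s) = inj₂ (proportional a b d c ab (two-squares-swap c d cd) (x²+y²≡2xy⇒x≡y (a * c) (b * d)
        (+-cancelʳ-≡ (q * q) _ _ (begin
          a * c * (a * c) + b * d * (b * d) + q * q
            ≡⟨ cong (λ s → a * c * (a * c) + b * d * (b * d) + s * s) s≡q ⟨
          a * c * (a * c) + b * d * (b * d) + (a * d + b * c) * (a * d + b * c)
            ≡⟨ lemma a b c d ⟩
          2 * (a * c * (b * d)) + (a * a + b * b) * (c * c + d * d)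
            ≡⟨ cong₂ (λ s t → 2 * (a * c * (b * d)) + s * t) ab cd ⟩
          2 * (a * c * (b * d)) + q * q ∎))))
        where
        lemma : ∀ a b c d → a * c * (a * c) + b * d * (b * d) + (a * d + b * c) * (a * d + b * c)
                          ≡ 2 * (a * c * (b * d)) + (a * a + b * b) * (c * c + d * d)
        lemma = solve-∀
        s≡q : a * d + b * c ≡ q
        s≡q = q∣m<2q⇒m≡q (subst (q ∣_) ad+bc q∣s)
          (≤-trans (*-mono-< (summand-positive b a (two-squares-swap a b ab)) (summand-positive c d cd)) (m≤m+n _ _))
          (+-mono-< ad<q bc<q)

    two-squares-unique : ∀ a b c d → a * a + b * b ≡ q → c * c + d * d ≡ q → a ≡ c ⊎ a ≡ d
    two-squares-unique a b c d ab cd = [ (λ bc≤ad → unique-from-cross a b c d ab cd (sym (m+[n∸m]≡n bc≤ad)))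
        , (λ ad≤bc → flip (unique-from-cross c d a b cd ab
            (trans (*-comm c b) (trans (sym (m+[n∸m]≡n ad≤bc)) (cong (_+ (b * c ∸ a * d)) (*-comm a d)))))) ]′ (≤-total (b * c) (a * d))
      where
      flip : c ≡ a ⊎ c ≡ b → a ≡ c ⊎ a ≡ d
      flip (inj₁ c≡a)  = inj₁ (sym c≡a)
      flip (inj₂ refl) = inj₂ (square-injective a d (+-cancelʳ-≡ (c * c) _ _ (trans ab (sym (two-squares-swap c d cd)))))

  -- Sums of two triangular numbers.

  module _ (p : ℕ) (prime : Prime (4 * p + 1)) where

    private
      q = 4 * p + 1
      q-odd : ¬ 2 ∣ q
      q-odd d = 2∤odd (2 * p) (subst (2 ∣_) (lemma p) d)
        where
        lemma : ∀ p → 4 * p + 1 ≡ suc (2 * (2 * p))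
        lemma = solve-∀

    -- With the larger argument written as y + e, the difference e of the arguments stays in ℕ, and
    -- 2y + e + 1 is their sum plus one.
    tri-sum⇒two-squares : ∀ e y → p ≡ tri (y + e) + tri y → e * e + suc (2 * y + e) * suc (2 * y + e) ≡ q
    tri-sum⇒two-squares e y eq = sym (begin
      4 * p + 1                                                 ≡⟨ cong (λ t → 4 * t + 1) eq ⟩
      4 * (tri (y + e) + tri y) + 1                             ≡⟨ lemma₁ (tri (y + e)) (tri y) ⟩
      2 * (2 * tri (y + e)) + 2 * (2 * tri y) + 1               ≡⟨ cong₂ (λ s t → 2 * s + 2 * t + 1) (2*tri (y + e)) (2*tri y) ⟩
      2 * ((y + e) * suc (y + e)) + 2 * (y * suc y) + 1         ≡⟨ lemma₂ y e ⟩
      e * e + suc (2 * y + e) * suc (2 * y + e)                 ∎)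
      where
      open ≡-Reasoning
      lemma₁ : ∀ s t → 4 * (s + t) + 1 ≡ 2 * (2 * s) + 2 * (2 * t) + 1
      lemma₁ = solve-∀
      lemma₂ : ∀ y e → 2 * ((y + e) * suc (y + e)) + 2 * (y * suc y) + 1 ≡ e * e + suc (2 * y + e) * suc (2 * y + e)
      lemma₂ = solve-∀

    tri-sum-irreflexive : ∀ {y} → p ≢ tri y + tri y
    tri-sum-irreflexive {y} eq = prime≢square prime (suc (2 * y + 0))
      (tri-sum⇒two-squares 0 y (trans eq (cong (λ t → tri t + tri y) (sym (+-identityʳ y)))))

    tri-sum-unique-≤ : ∀ e y e′ y′ → p ≡ tri (y + e) + tri y → p ≡ tri (y′ + e′) + tri y′ → _≡_ {A = ℕ × ℕ} (y + e , y) (y′ + e′ , y′)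
    tri-sum-unique-≤ e y e′ y′ eq eq′ = go (two-squares-unique prime e (suc (2 * y + e)) e′ (suc (2 * y′ + e′)) sq sq′)
      where
      sq  = tri-sum⇒two-squares e y eq
      sq′ = tri-sum⇒two-squares e′ y′ eq′
      go : e ≡ e′ ⊎ e ≡ suc (2 * y′ + e′) → _≡_ {A = ℕ × ℕ} (y + e , y) (y′ + e′ , y′)
      go (inj₁ refl) = cong (λ t → t + e , t) (*-cancelˡ-≡ y y′ 2 (+-cancelʳ-≡ e _ _ (suc-injective
        (square-injective (suc (2 * y + e)) (suc (2 * y′ + e)) (+-cancelˡ-≡ (e * e) _ _ (trans sq (sym sq′)))))))
      -- The squares would have changed places, so that e = 2y′ + e′ + 1 > e′ and e′ = 2y + e + 1 >
      -- e at once.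
      go (inj₂ refl) = contradiction (square-injective (suc (2 * y + e)) e′ (+-cancelˡ-≡ (e * e) _ _ (trans sq (trans (sym sq′) (+-comm (e′ * e′) _)))))
        (>⇒≢ (s≤s (≤-trans (m≤n⇒m≤1+n (m≤n+m e′ (2 * y′))) (m≤n+m e (2 * y)))))

    tri-sum-unique : ∀ {a b c d} → b ≤ a → d ≤ c → p ≡ tri a + tri b → p ≡ tri c + tri d → (a , b) ≡ (c , d)
    tri-sum-unique {a} {b} {c} {d} b≤a d≤c eq eq′ =
      subst₂ (λ a c → (a , b) ≡ (c , d)) (m+[n∸m]≡n b≤a) (m+[n∸m]≡n d≤c) (tri-sum-unique-≤ (a ∸ b) b (c ∸ d) d
        (trans eq (cong (λ t → tri t + tri b) (sym (m+[n∸m]≡n b≤a))))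
        (trans eq′ (cong (λ t → tri t + tri d) (sym (m+[n∸m]≡n d≤c)))))

    tri-sum-from-double : ∀ a b → 2 * p ≡ a * suc a + b * suc b → p ≡ tri a + tri b
    tri-sum-from-double a b eq = *-cancelˡ-≡ p _ 2 (trans eq (trans (sym (cong₂ _+_ (2*tri a) (2*tri b))) (sym (*-distribˡ-+ 2 (tri a) (tri b)))))

    tri-sum-exists : ∃₂ λ a b → b ≤ a × p ≡ tri a + tri b
    tri-sum-exists with Zagier.swap-fixed-point q prime q-odd p refl
    ... | x , y , sol with even-or-odd x
    ...   | k , inj₁ refl = contradiction (subst (2 ∣_) sol
              (divides (2 * (k * k) + 2 * (y * y)) (lemma k y))) q-odd
      where
      lemma : ∀ k y → 2 * k * (2 * k) + 4 * (y * y) ≡ (2 * (k * k) + 2 * (y * y)) * 2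
      lemma = solve-∀
    ...   | k , inj₂ refl = [ small , large ]′ (≤-<-connex y k)
      where
      p≡ : p ≡ k * k + k + y * y
      p≡ = *-cancelˡ-≡ p _ 4 (+-cancelʳ-≡ 1 _ _ (trans (sym sol) (lemma k y)))
        where
        lemma : ∀ k y → suc (2 * k) * suc (2 * k) + 4 * (y * y) ≡ 4 * (k * k + k + y * y) + 1
        lemma = solve-∀
      -- The witnesses come from k² + k + y² = T(k+y) + T(k-y). When k < y, T(-n) = T(n-1) replaces
      -- k - y by y - k - 1; in both cases the first witness is k + y.
      small : y ≤ k → ∃₂ λ a b → b ≤ a × p ≡ tri a + tri b
      small y≤k = 2 * y + j , j , m≤n+m j (2 * y) , tri-sum-from-double (2 * y + j) j (trans
        (cong (2 *_) (trans p≡ (cong (λ t → t * t + t + y * y) (sym (m+[n∸m]≡n y≤k))))) (lemma y j))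
        where
        j = k ∸ y
        lemma : ∀ y j → 2 * ((y + j) * (y + j) + (y + j) + y * y) ≡ (2 * y + j) * suc (2 * y + j) + j * suc j
        lemma = solve-∀
      large : k < y → ∃₂ λ a b → b ≤ a × p ≡ tri a + tri b
      large k<y = suc (2 * k) + j , j , m≤n+m j (suc (2 * k)) , tri-sum-from-double (suc (2 * k) + j) j (trans
        (cong (2 *_) (trans p≡ (cong (λ t → k * k + k + t * t) (sym (m+[n∸m]≡n k<y))))) (lemma k j))
        where
        j = y ∸ suc k
        lemma : ∀ k j → 2 * (k * k + k + (suc k + j) * (suc k + j)) ≡ (suc (2 * k) + j) * suc (suc (2 * k) + j) + j * suc j
        lemma = solve-∀

  length≡2 : ∀ {a} {A : Set a} {u v : A} {xs} → Unique xs → u ∈ xs → v ∈ xs → u ≢ v →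
             (∀ {x} → x ∈ xs → x ≡ u ⊎ x ≡ v) → length xs ≡ 2
  length≡2 {u = u} {v} {xs} uniq u∈ v∈ u≢v only with unique-extract u∈ uniq
  ... | ys , xs↭ , (u∉ys ∷ uniq-ys) with ↭.∈-resp-↭ xs↭ v∈
  ...   | here v≡u    = contradiction (sym v≡u) u≢v
  ...   | there v∈ys with unique-extract v∈ys uniq-ys
  ...     | [] , ys↭ , _ = trans (↭.↭-length xs↭) (cong suc (↭.↭-length ys↭))
  ...     | z ∷ zs , ys↭ , ((v≢z ∷ _) ∷ _) = contradiction (only (↭.∈-resp-↭ (↭-sym xs↭) (there z∈ys)))
              [ (λ z≡u → All.lookup u∉ys z∈ys (sym z≡u)) , (λ z≡v → v≢z (sym z≡v)) ]′
    where
    z∈ys = ↭.∈-resp-↭ (↭-sym ys↭) (there (here refl))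

  concatMap-pairs : ∀ {a} {A : Set a} (xs ys : List A) → concatMap (λ a → map (λ b → (a , b)) ys) xs ≡ cartesianProduct xs ys
  concatMap-pairs []       ys = refl
  concatMap-pairs (x ∷ xs) ys = cong (map (x ,_) ys ++_) (concatMap-pairs xs ys)

  -- The two solutions are a pair and its transpose. They differ because equal entries v would make
  -- 4p + 1 the square of 2v + 1.
  t₂-prime : ∀ p → Prime (4 * p + 1) → t₂ p ≡ 2
  t₂-prime p prime-q with tri-sum-exists p prime-q
  ... | u , v , v≤u , sum≡ = trans
      (cong (λ xs → length (filter P? xs)) (concatMap-pairs (upTo (suc p)) (upTo (suc p))))
      (length≡2 (Unique.filter⁺ P? (Unique.cartesianProduct⁺ (Unique.upTo⁺ (suc p)) (Unique.upTo⁺ (suc p))))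
        (member sum≡) (member sum≡′)
        (λ eq → tri-sum-irreflexive p prime-q {v} (trans sum≡ (cong (λ t → tri t + tri v) (cong proj₁ eq))))
        (λ {x} x∈ → only x (proj₂ (∈-filter⁻ P? {xs = pairs} x∈))))
    where
    P? : (xy : ℕ × ℕ) → Dec (p ≡ tri (proj₁ xy) + tri (proj₂ xy))
    P? xy = p ≟ (tri (proj₁ xy) + tri (proj₂ xy))
    pairs : List (ℕ × ℕ)
    pairs = cartesianProduct (upTo (suc p)) (upTo (suc p))
    sum≡′ : p ≡ tri v + tri u
    sum≡′ = trans sum≡ (+-comm (tri u) (tri v))
    member : ∀ {a b} → p ≡ tri a + tri b → (a , b) ∈ filter P? pairs
    member {a} {b} eq = ∈-filter⁺ P? (∈-cartesianProduct⁺
      (∈-upTo⁺ (s≤s (≤-trans (n≤tri a) (≤-trans (m≤m+n _ _) (≤-reflexive (sym eq))))))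
      (∈-upTo⁺ (s≤s (≤-trans (n≤tri b) (≤-trans (m≤n+m _ _) (≤-reflexive (sym eq))))))) eq
    only : ∀ x → p ≡ tri (proj₁ x) + tri (proj₂ x) → x ≡ (u , v) ⊎ x ≡ (v , u)
    only (a , b) eq with ≤-total b a
    ... | inj₁ b≤a = inj₁ (tri-sum-unique p prime-q b≤a v≤u eq sum≡)
    ... | inj₂ a≤b = inj₂ (cong (λ { (s , t) → t , s }) (tri-sum-unique p prime-q a≤b v≤u (trans eq (+-comm (tri a) (tri b))) sum≡))

-- The divisor function on ℚ and the recursion at a prime index.

open import Data.Integer using (ℤ; +_; _+_; _-_; _*_; -[1+_])
open import Data.Integer.Tactic.RingSolver using (solve-∀)
open import Data.Nat.Coprimality using (1-coprimeTo) renaming (sym to coprime-sym)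
open import Data.Rational using (mkℚ; _/_; toℚᵘ)
import Data.Rational.Properties as ℚ
open import Data.Rational.Unnormalised using (mkℚᵘ; *≡*) renaming (_≃_ to _≃ᵘ_)
open import Relation.Binary.PropositionalEquality
open PowerSeries
open ThetaSeries
open Triangular
open TwoSquares using (t₂-prime; prime≢square)

σ-integer : ∀ m → σ (+ suc m / 1) ≡ σℕ (suc m)
σ-integer m = cong σ (ℚ.↥p/↧p≡p (mkℚ (+ suc m) 0 (coprime-sym (1-coprimeTo (suc m)))))

σ-half-even : ∀ m → σ (+ (2 ℕ.* suc m) / 2) ≡ σℕ (suc m)
σ-half-even m = trans
  (cong σ (ℚ.fromℚᵘ-cong {mkℚᵘ (+ (2 ℕ.* suc m)) 1} {mkℚᵘ (+ suc m) 0} (*≡* (cong +_ (trans (ℕ.*-identityʳ _) (ℕ.*-comm 2 (suc m)))))))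
  (σ-integer m)

-- The reduction by a gcd inside `_/_` does not compute at a variable m, so an arbitrary r
-- equivalent to (2m+1)/2 is inspected: a positive integer r would make 2m + 1 even, r = 0 is
-- absurd, and elsewhere σ is 0 by definition.
σ-half-odd : ∀ m → σ (+ suc (2 ℕ.* m) / 2) ≡ 0
σ-half-odd m = go (+ suc (2 ℕ.* m) / 2) (ℚ.toℚᵘ-fromℚᵘ (mkℚᵘ (+ suc (2 ℕ.* m)) 1))
  where
  go : ∀ r → toℚᵘ r ≃ᵘ mkℚᵘ (+ suc (2 ℕ.* m)) 1 → σ r ≡ 0
  go (mkℚ (+ zero) zero _)     (*≡* ())
  go (mkℚ (+ suc k) zero _)    (*≡* eq) = contradiction
    (divides (suc k) (trans (sym (ℕ.*-identityʳ _)) (sym (ℤ.+-injective eq)))) (2∤odd m)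
  go (mkℚ (+ zero) (suc _) _)  _ = refl
  go (mkℚ (+ suc _) (suc _) _) _ = refl
  go (mkℚ -[1+ _ ] _ _)        _ = refl

σℕ-prime : ∀ {p} → Prime p → + σℕ p ≡ + 1 + + p
σℕ-prime {0} prime-p = contradiction prime-p ¬prime[0]
σℕ-prime {1} prime-p = contradiction prime-p ¬prime[1]
σℕ-prime {p@(suc (suc n))} prime-p = begin
  + σℕ p                                                                ≡⟨ sumFrom1-lambert (suc n) ℕ.≤-refl ⟨
  sumFrom1 (suc n) (λ k → lambert k p) + lambert p p                    ≡⟨ cong₂ _+_ (sumFrom1-head n _) (lambert-∣ p (suc n) ∣-refl) ⟩
  lambert 1 p + sumFrom1 n (λ k → lambert (suc k) p) + + p              ≡⟨ cong₂ (λ x y → x + y + + p) (lambert-∣ 1 (suc n) (1∣ p)) (sumFrom1-zero n proper) ⟩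
  + 1 + + p                                                             ∎
  where
  open ≡-Reasoning
  proper : ∀ k → 1 ≤ k → k ≤ n → lambert (suc k) p ≡ + 0
  proper k 1≤k k≤n = lambert-∤ (suc k) p λ d → not-divisor (prime⇒irreducible prime-p d)
    where
    not-divisor : ¬ (suc k ≡ 1 ⊎ suc k ≡ p)
    not-divisor (inj₁ k+1≡1) = ℕ.m<n⇒n≢0 1≤k (ℕ.suc-injective k+1≡1)
    not-divisor (inj₂ k+1≡p) = ℕ.<⇒≢ (s≤s (s≤s k≤n)) k+1≡p

-- Positivity of m matters: at 0 the left side is 0, but the convention σ(0) = 1 makes the right
-- side 1 - 4 = -3.
lambertSum-σ : ∀ M n m → 0 < m → m ≤ 2 ℕ.* n → Coefficients.lambertSum M n m ≡ + σ (+ m / 1) - + 4 * + σ (+ m / 2)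
lambertSum-σ M n m 0<m m≤2n with even-or-odd m
... | zero , inj₁ refl = contradiction 0<m λ ()
... | suc k , inj₁ refl = trans (Coefficients.lambertSum-even M n k (ℕ.*-cancelˡ-≤ 2 m≤2n))
        (sym (cong₂ (λ x y → + x - + 4 * + y) (σ-integer (k ℕ.+ 1 ℕ.* suc k)) (σ-half-even k)))
... | k , inj₂ refl = trans (Coefficients.lambertSum-odd M n k m≤2n)
        (trans (sym (ℤ.+-identityʳ _)) (sym (cong₂ (λ x y → + x - + 4 * + y) (σ-integer (2 ℕ.* k)) (σ-half-odd k))))

odd-case : ∀ k → let p = suc (2 ℕ.* k) in Prime p → Prime (4 ℕ.* p ℕ.+ 1) →
  sumFrom1 (2 ℕ.* k) (λ j → + t₂ j * (+ σ (+ (p ∸ j) / 1) - + 4 * + σ (+ (p ∸ j) / 2))) ≡ -[1+ 0 ]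
odd-case k prime-p prime-q = solve-for-S (begin
  + p * + 2                     ≡⟨ cong (λ t → + p * + t) (t₂-prime p prime-q) ⟨
  + p * + t₂ p                  ≡⟨ cong (_*_ (+ p)) (ψ²-t₂ {p} p<M) ⟨
  D (f ⊛ f) p                   ≡⟨ D-ψ² p ℕ.≤-refl p p<M ⟩
  (f ⊛ f ⊛ lambertSum p) p + (f ⊛ f ⊛ lambertSum p) p
                                ≡⟨ cong (λ x → x + x) expand ⟩
  (+ 1 + + p + S) + (+ 1 + + p + S) ∎)
  where
  open ≡-Reasoning
  p = suc (2 ℕ.* k)
  -- One number in two roles: the precision, and the count 2p + 1 of terms of ψ matching the product
  -- with n = p, for which `D-ψ²` asks that M ≤ 2p + 1.
  M = suc (2 ℕ.* p)
  open Coefficients M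
  f : Series
  f = ψ M
  p≤2p : p ≤ 2 ℕ.* p
  p≤2p = ℕ.m≤m+n p _
  p<M : p < M
  p<M = s≤s p≤2p
  S : ℤ
  S = sumFrom1 (2 ℕ.* k) (λ j → + t₂ j * (+ σ (+ (p ∸ j) / 1) - + 4 * + σ (+ (p ∸ j) / 2)))
  interior : ∀ j → 1 ≤ j → j ≤ 2 ℕ.* k → (f ⊛ f) j * lambertSum p (p ∸ j) ≡ + t₂ j * (+ σ (+ (p ∸ j) / 1) - + 4 * + σ (+ (p ∸ j) / 2))
  interior j 1≤j j≤2k = cong₂ _*_ (ψ²-t₂ (ℕ.≤-<-trans (ℕ.m≤n⇒m≤1+n j≤2k) p<M))
    (lambertSum-σ M p (p ∸ j) (ℕ.m<n⇒0<n∸m (s≤s j≤2k)) (ℕ.≤-trans (ℕ.m∸n≤m p j) p≤2p))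
  -- The convolution also has a term j = p, beyond the range of S; it drops out because Lambert
  -- series have no constant term.
  lambertSum-0 : lambertSum p (p ∸ p) ≡ + 0
  lambertSum-0 = trans (cong (lambertSum p) (ℕ.n∸n≡0 p)) (trans (lambertSum-split p 0)
    (cong₂ (λ x y → x - + 2 * y) (sumFrom1-zero (2 ℕ.* p) (λ _ _ _ → refl)) (sumFrom1-zero p (λ _ _ _ → refl))))
  expand : (f ⊛ f ⊛ lambertSum p) p ≡ + 1 + + p + S
  expand = begin
    (f ⊛ f ⊛ lambertSum p) p
      ≡⟨ ⊛-sumFrom1 (f ⊛ f) (lambertSum p) p ⟩
    (f ⊛ f) 0 * lambertSum p p + (sumFrom1 (2 ℕ.* k) (λ j → (f ⊛ f) j * lambertSum p (p ∸ j)) + (f ⊛ f) p * lambertSum p (p ∸ p))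
      ≡⟨ cong₂ _+_ (cong₂ _*_ (ψ²-t₂ {0} {M} (s≤s z≤n)) (trans (lambertSum-odd p k p≤2p) (σℕ-prime prime-p)))
                   (cong₂ _+_ (sumFrom1-cong (2 ℕ.* k) interior) (trans (cong (_*_ ((f ⊛ f) p)) lambertSum-0) (ℤ.*-zeroʳ ((f ⊛ f) p)))) ⟩
    + 1 * (+ 1 + + p) + (S + + 0)
      ≡⟨ cong₂ _+_ (ℤ.*-identityˡ (+ 1 + + p)) (ℤ.+-identityʳ S) ⟩
    + 1 + + p + S ∎
  solve-for-S : + p * + 2 ≡ (+ 1 + + p + S) + (+ 1 + + p + S) → S ≡ -[1+ 0 ]
  solve-for-S eq = ℤ.*-cancelˡ-≡ (+ 2) S -[1+ 0 ] (begin
    + 2 * S                                                    ≡⟨ lemma (+ p) S ⟩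
    (+ 1 + + p + S) + (+ 1 + + p + S) - (+ p * + 2 + + 2)      ≡⟨ cong (_- (+ p * + 2 + + 2)) eq ⟨
    + p * + 2 - (+ p * + 2 + + 2)                              ≡⟨ lemma′ (+ p) ⟩
    + 2 * -[1+ 0 ]                                             ∎)
    where
    lemma : ∀ p S → + 2 * S ≡ (+ 1 + p + S) + (+ 1 + p + S) - (p * + 2 + + 2)
    lemma = solve-∀
    lemma′ : ∀ p → p * + 2 - (p * + 2 + + 2) ≡ + 2 * -[1+ 0 ]
    lemma′ = solve-∀

theorem4p1 : (p : ℕ) → Prime p → Prime (4 Data.Nat.* p Data.Nat.+ 1) →
    sumFrom1 (p ∸ 1)
    (λ j → (+ t₂ j) * ((+ σ ((+ (p ∸ j)) / 1)) - (+ 4) * (+ σ ((+ (p ∸ j)) / 2))))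
    ≡ -[1+ 0 ]
theorem4p1 p prime-p prime-q with even-or-odd p
... | k , inj₂ refl = odd-case k prime-p prime-q
... | k , inj₁ refl with prime⇒irreducible prime-p (m∣m*n {2} k)
...   | inj₁ ()
...   | inj₂ 2≡2k = contradiction refl (prime≢square (subst (λ p → Prime (4 ℕ.* p ℕ.+ 1)) (sym 2≡2k) prime-q) 3)
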